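{- Consider any cell-probe data structure, possibly using Las Vegas randomization, for the partial-sum problem on an array $A$ of length $n$ with values from $0$ to $U$, where $U\ge n^{\Omega(1)}$. Let $E\le n^{\mathcal{O}(1)}$. The data structure requires $\Omega(En\log n)$ time to process $\Theta(En)$ operations, even if the sequence of operations is assumed to be epoch-based and to comprise $E$ epochs.
   Context: In the partial-sum problem, one maintains an integer array $A$ of length $n$ under $\textsf{update}(i,x)$ (set $A[i]\gets x$) and $\textsf{partial-sum}(p)$ (return $\sum_{i=1}^p A[i]$). A sequence of operations is epoch-based with $E$ epochs if it can be partitioned into $E$ consecutive epochs such that within each epoch every element of $A$ is updated exactly once and every prefix sum (for each $p\in[n]$) is queried exactly once. In the cell-probe model, time is measured only by the number of memory cells (words of $\Theta(\log n)$ bits) accessed; computation is free. For a Las Vegas randomized structure the time is the expected number of probes. -}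

module Defs where

open import Data.Bool.Base using (Bool; true; false)
open import Data.Fin.Base using (Fin; toℕ)
import Data.Fin.Properties as Fin
open import Data.Integer.Base using (+_)
open import Data.List.Base using (List; []; _∷_; length; map; take; filter; mapMaybe; concat; _++_; cartesianProductWith)
open import Data.List.Properties using (length-map; length-++)
open import Data.List.Relation.Unary.All using (All; []; _∷_)
open import Data.Maybe.Base using (Maybe; just; nothing)
open import Data.Nat.Base using (ℕ; zero; suc; _+_; _*_; _^_)
open import Data.Nat.ListAction using (sum)
import Data.Nat.Properties as ℕ
open import Data.Product.Base using (Σ-syntax; ∃-syntax; _×_; _,_; proj₁; proj₂)
open import Data.Rational.Unnormalised.Base using (ℚᵘ; 0ℚᵘ; _/_; _≤_; _<_)
open import Data.Unit.Base using (⊤; tt)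
open import Data.Vec.Base as Vec using (Vec; []; _∷_; toList; _[_]≔_)
open import Relation.Binary.PropositionalEquality using (_≡_; refl; cong; cong₂; module ≡-Reasoning)
open import Relation.Nullary.Decidable using (yes; no)

Array : ℕ → ℕ → Set
Array n U = Vec (Fin (suc U)) n

-- Positions are 0-based: partial-sum p asks for A[0] + ... + A[p].
data Op (n U : ℕ) : Set where
  update      : Fin n → Fin (suc U) → Op n U
  partial-sum : Fin n → Op n U

Answer : ∀ {n U} → Op n U → Set
Answer (update _ _)    = ⊤
Answer (partial-sum _) = ℕ

prefixSum : ∀ {n U} → Array n U → Fin n → ℕ
prefixSum A p = sum (take (suc (toℕ p)) (map toℕ (toList A)))

answers : ∀ {n U} → Array n U → (ops : List (Op n U)) → All Answer ops
answers A []                    = []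
answers A (update i x ∷ ops)    = tt ∷ answers (A [ i ]≔ x) ops
answers A (partial-sum p ∷ ops) = prefixSum A p ∷ answers A ops

updateIndex : ∀ {n U} → Op n U → Maybe (Fin n)
updateIndex (update i _)    = just i
updateIndex (partial-sum _) = nothing

queryIndex : ∀ {n U} → Op n U → Maybe (Fin n)
queryIndex (update _ _)    = nothing
queryIndex (partial-sum p) = just p

occurrences : ∀ {n} → Fin n → List (Fin n) → ℕ
occurrences i is = length (filter (i Fin.≟_) is)

IsEpoch : ∀ {n U} → List (Op n U) → Set
IsEpoch {n} ops =
    ((i : Fin n) → occurrences i (mapMaybe updateIndex ops) ≡ 1)
  × ((p : Fin n) → occurrences p (mapMaybe queryIndex ops) ≡ 1)

EpochBased : ∀ {n U} → ℕ → List (Op n U) → Set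
EpochBased {n} {U} E ops =
  Σ[ epochs ∈ List (List (Op n U)) ]
    length epochs ≡ E × All IsEpoch epochs × ops ≡ concat epochs

Word : ℕ → Set
Word w = Fin (2 ^ w)

-- The number of cells is not bounded: any address space embeds in ℕ.
Address : Set
Address = ℕ

Memory : ℕ → Set
Memory w = Address → Word w

store : ∀ {w} → Memory w → Address → Word w → Memory w
store m a x b with a ℕ.≟ b
... | yes _ = x
... | no  _ = m b

-- The random bits visible to an operation: one tape common to the whole run,
-- and one tape of fresh bits of its own.
data Tape : Set where
  shared own : Tape

data Action (w : ℕ) (R : Set) : Set where
  read   : Address → Action w R
  write  : Address → Word w → Action w R
  coin   : Tape → ℕ → Action w R
  return : R → Action w R

data Response (w : ℕ) : Set where
  word : Word w → Response w
  ack  : Response w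
  bit  : Bool → Response w

-- Computation is free: the next action is an arbitrary function of the
-- operation and of the responses obtained during this operation (latest
-- first).  Only the memory cells carry information between operations.
record Algorithm (n U w : ℕ) : Set where
  field
    initial : Memory w
    next    : (o : Op n U) → List (Response w) → Action w (Answer o)

-- Execution truncated at level k: only the first k bits of each tape are
-- available and each operation may perform fewer than k actions before
-- returning.  A run exceeding these limits stops with result 'nothing'.

-- Number of probes performed, and the result if there is one.
Outcome : Set → Set
Outcome R = ℕ × Maybe R

probe : ∀ {R} → Outcome R → Outcome R
probe (c , r) = suc c , r

bitAt : ∀ {k} → Vec Bool k → ℕ → Maybe Bool
bitAt []       _       = nothing
bitAt (b ∷ _)  zero    = just b
bitAt (_ ∷ bs) (suc j) = bitAt bs j

module _ {w k : ℕ} {R : Set} (next : List (Response w) → Action w R)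
         (tape : Tape → Vec Bool k) where

  mutual
    exec : ℕ → List (Response w) → Memory w → Outcome (R × Memory w)
    exec zero       h m = 0 , nothing
    exec (suc fuel) h m = perform fuel h m (next h)

    perform : ℕ → List (Response w) → Memory w → Action w R → Outcome (R × Memory w)
    perform fuel h m (read a)    = probe (exec fuel (word (m a) ∷ h) m)
    perform fuel h m (write a x) = probe (exec fuel (ack ∷ h) (store {w} m a x))
    perform fuel h m (coin t j)  = toss fuel h m (bitAt (tape t) j)
    perform fuel h m (return r)  = 0 , just (r , m)

    toss : ℕ → List (Response w) → Memory w → Maybe Bool → Outcome (R × Memory w)
    toss fuel h m (just b) = exec fuel (bit b ∷ h) m
    toss fuel h m nothing  = 0 , nothing

tapes : ∀ {k} → Vec Bool k → Vec Bool k → Tape → Vec Bool k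
tapes σ ρ shared = σ
tapes σ ρ own    = ρ

module _ {n U w : ℕ} (D : Algorithm n U w) where
  open Algorithm D

  prepend : ∀ {o : Op n U} {ops} → ℕ → Answer o → Outcome (All Answer ops) → Outcome (All Answer (o ∷ ops))
  prepend c r (c′ , just rs) = c + c′ , just (r ∷ rs)
  prepend c r (c′ , nothing) = c + c′ , nothing

  mutual
    runFrom : ∀ {k} → Memory w → Vec Bool k → (ops : List (Op n U)) →
              Vec (Vec Bool k) (length ops) → Outcome (All Answer ops)
    runFrom     m σ []        []       = 0 , just []
    runFrom {k} m σ (o ∷ ops) (ρ ∷ ρs) = resume σ o ops ρs (exec (next o) (tapes σ ρ) k [] m)

    resume : ∀ {k} → Vec Bool k → (o : Op n U) (ops : List (Op n U)) →
             Vec (Vec Bool k) (length ops) → Outcome (Answer o × Memory w) →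
             Outcome (All Answer (o ∷ ops))
    resume σ o ops ρs (c , nothing)       = c , nothing
    resume σ o ops ρs (c , just (r , m)) = prepend c r (runFrom m σ ops ρs)

-- All tape contents for T operations: the head is the shared tape, the
-- remaining rows are the operations' own tapes.
Coins : ℕ → ℕ → Set
Coins k T = Vec (Vec Bool k) (suc T)

run : ∀ {n U w k} → Algorithm n U w → (ops : List (Op n U)) →
      Coins k (length ops) → Outcome (All Answer ops)
run D ops (σ ∷ ρs) = runFrom D (Algorithm.initial D) σ ops ρs

probes : ∀ {n U w k} → Algorithm n U w → (ops : List (Op n U)) → Coins k (length ops) → ℕ
probes D ops ω = proj₁ (run D ops ω)

result : ∀ {n U w k} → Algorithm n U w → (ops : List (Op n U)) →
         Coins k (length ops) → Maybe (All Answer ops)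
result D ops ω = proj₂ (run D ops ω)

vectors : ∀ {A : Set} → List A → (n : ℕ) → List (Vec A n)
vectors xs zero    = [] ∷ []
vectors xs (suc n) = cartesianProductWith _∷_ xs (vectors xs n)

allCoins : ∀ k T → List (Coins k T)
allCoins k T = vectors (vectors (true ∷ false ∷ []) k) (suc T)

mean : ∀ k T → (Coins k T → ℕ) → ℚᵘ
mean k T f = ((+ sum (map f (allCoins k T))) / ((2 ^ k) ^ suc T))
               {{ℕ.m^n≢0 (2 ^ k) (suc T) {{ℕ.m^n≢0 2 k}}}}

length-cartesianProductWith : ∀ {A B C : Set} (f : A → B → C) xs ys →
  length (cartesianProductWith f xs ys) ≡ length xs * length ys
length-cartesianProductWith f []       ys = refl
length-cartesianProductWith f (x ∷ xs) ys = begin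
  length (map (f x) ys ++ cartesianProductWith f xs ys)
    ≡⟨ length-++ (map (f x) ys) ⟩
  length (map (f x) ys) + length (cartesianProductWith f xs ys)
    ≡⟨ cong₂ _+_ (length-map (f x) ys) (length-cartesianProductWith f xs ys) ⟩
  length ys + length xs * length ys ∎
  where open ≡-Reasoning

length-vectors : ∀ {A : Set} (xs : List A) n → length (vectors xs n) ≡ length xs ^ n
length-vectors xs zero    = refl
length-vectors xs (suc n) rewrite length-cartesianProductWith (Vec._∷_ {n = n}) xs (vectors xs n) =
  cong (length xs *_) (length-vectors xs n)

-- The denominator in 'mean' is the number of outcomes.
length-allCoins : ∀ k T → length (allCoins k T) ≡ (2 ^ k) ^ suc T
length-allCoins k T rewrite length-vectors (vectors (true ∷ false ∷ []) k) (suc T) =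
  cong (_^ suc T) (length-vectors (true ∷ false ∷ []) k)

-- The truncated means increase with k, and by monotone convergence their
-- supremum (possibly ∞) is the expected number of probes; this says that
-- the supremum is at least b.
ExpectedProbes≥ : ∀ {n U w} → Algorithm n U w → List (Op n U) → ℚᵘ → Set
ExpectedProbes≥ D ops b =
  ∀ q → q < b → ∃[ k ] q ≤ mean k (length ops) (probes D ops)

undefined# : ∀ {A : Set} → Maybe A → ℕ
undefined# (just _) = 0
undefined# nothing  = 1

HaltsAlmostSurely : ∀ {n U w} → Algorithm n U w → List (Op n U) → Set
HaltsAlmostSurely D ops =
  ∀ ε → 0ℚᵘ < ε → ∃[ k ] mean k (length ops) (λ ω → undefined# (result D ops ω)) ≤ ε

NeverErrs : ∀ {n U w} → Array n U → Algorithm n U w → List (Op n U) → Set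
NeverErrs A D ops =
  ∀ k (ω : Coins k (length ops)) rs → result D ops ω ≡ just rs → rs ≡ answers A ops

-- A Las Vegas structure for the array A that is only required to work on
-- epoch-based sequences with E epochs.
record LasVegasPartialSums (n U w E : ℕ) (A : Array n U) : Set where
  field
    algorithm : Algorithm n U w
    halts     : ∀ ops → EpochBased E ops → HaltsAlmostSurely algorithm ops
    correct   : ∀ ops → EpochBased E ops → NeverErrs A algorithm ops

{-# OPTIONS --safe #-}
module Submission where

open import Defs
open import Data.Bool.Base using (Bool; true; false; if_then_else_)
open import Data.Fin.Base using (Fin; zero; suc; toℕ)
open import Data.Fin.Properties as Fin using (toℕ-injective; toℕ-fromℕ<)
open import Data.Integer.Base as ℤ using (+_; +≤+; +<+)
import Data.Integer.Properties as ℤ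
open import Data.List.Base using (List; []; _∷_; length; map; _++_; mapMaybe; filter; cartesianProduct; cartesianProductWith; allFin)
open import Data.List.Membership.Propositional using (_∈_)
open import Data.List.Membership.Propositional.Properties using (∈-∃++; ∈-++⁺ˡ; ∈-++⁺ʳ; ∈-++⁻; ∈-map⁺; ∈-map⁻; ∈-filter⁻; ∈-cartesianProduct⁺; ∈-cartesianProductWith⁺; ∈-allFin)
open import Data.List.Properties using (map-++; map-∘; ∷-injective; length-++; length-map; length-tabulate; mapMaybe-++; filter-++; filter-accept; filter-reject)
open import Data.List.Relation.Unary.All as All using (All; []; _∷_)
import Data.List.Relation.Unary.All.Properties as All
open import Data.List.Relation.Unary.Any using (here; there)
open import Data.List.Relation.Unary.Unique.Propositional using (Unique; []; _∷_)
import Data.List.Relation.Unary.Unique.Propositional.Properties as Unique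
open import Data.Maybe.Base using (Maybe; just; nothing)
open import Data.Maybe.Properties using (just-injective)
open import Data.Nat.Base
open import Data.Nat.DivMod using (_mod_; m<n⇒m%n≡m; m%n<n)
open import Data.Nat.Induction using (<-rec)
open import Data.Nat.ListAction using (sum)
open import Data.Nat.ListAction.Properties using (sum-++)
open import Data.Nat.Logarithm using (⌊log₂_⌋; ⌊log₂⌋-mono-≤; ⌊log₂⌊n/2⌋⌋≡⌊log₂n⌋∸1; ⌊log₂[2^n]⌋≡n)
open import Data.Nat.Properties
open import Data.Nat.Solver using (module +-*-Solver)
open import Data.Product.Base using (Σ-syntax; ∃-syntax; _×_; _,_; proj₁; proj₂)
open import Data.Rational.Unnormalised.Base as ℚᵘ using (ℚᵘ; 0ℚᵘ; *≤*; *<*)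
import Data.Rational.Unnormalised.Properties as ℚᵘ
open import Data.Sum.Base using (_⊎_; inj₁; inj₂)
open import Data.Unit.Base using (⊤; tt)
open import Data.Vec.Base as Vec using (Vec; []; _∷_; lookup; _[_]≔_)
open import Data.Vec.Properties using (lookup∘update; lookup∘update′)
open import Function.Base using (id; _∘_)
open import Relation.Binary.Definitions using (tri<; tri≈; tri>)
open import Relation.Binary.PropositionalEquality
open import Relation.Nullary.Decidable using (yes; no; does; _×-dec_; dec-true)
open import Relation.Nullary.Negation using (contradiction)
open import Relation.Unary using (Decidable)
open +-*-Solver using (solve; con; _:+_; _:*_; _:=_)

-- The information-transfer method of Pătraşcu and Demaine.  In each epoch the
-- first 2^d positions are updated and queried in bit-reversed order, with
-- arbitrary values: recursively, first the even positions, then the odd ones.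
-- Fix the coins and all values outside the even half of a block.  The odd half
-- can be simulated from a transcript of the reads whose cell was last written
-- during the even half, and its answers determine all values of the even half,
-- because the positions interleave.  Hence the transcript is injective in these
-- values; as there are few sparse transcripts, half of the values cause many
-- such reads.  A read is counted for only one block, the smallest one that
-- contains it together with the last write to its cell, so the d levels add up.
-- For a randomised structure, the truncation level k is chosen so large that
-- for at least half of the coins the run halts on every sequence of the family.

-- Finite sums

-- Addresses are unbounded, so a transcript cannot afford to name cells. It names probes instead:
-- its i-th entry belongs to the i-th probe of the odd half, and a simulation that is correct so far
-- knows the cell concerned. An entry then costs log of the run length plus w bits, which is O(log
-- n) only for runs of polynomial length. Hence the cap `M`: a run beyond it is charged the
-- threshold outright, which is fair because `M` is the whole bound to be proved, so that such a run
-- has paid it already. E ≤ n^O(1) gives log M = O(log n), and U ≥ n^Ω(1) lets a constant number 2^g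
-- of values pay for one entry. Blocks of at most 2^g positions hold too little information; these g
-- levels are given up, at the price of a constant factor once log n > 2g. Injectivity compares two
-- runs with the same coins, so for these coins the structure must be right on all values, not only
-- on most of them. This is why a failure rate of 1/(2 · size of the family) is demanded of every
-- sequence.

sumOver : {X : Set} → List X → (X → ℕ) → ℕ
sumOver xs f = sum (map f xs)

module _ {X : Set} where

  sumOver-mono-All : ∀ {f g : X → ℕ} {xs} → All (λ x → f x ≤ g x) xs → sumOver xs f ≤ sumOver xs g
  sumOver-mono-All []       = z≤n
  sumOver-mono-All (p ∷ ps) = +-mono-≤ p (sumOver-mono-All ps)

  sumOver-mono : ∀ {f g : X → ℕ} xs → (∀ x → f x ≤ g x) → sumOver xs f ≤ sumOver xs g
  sumOver-mono xs p = sumOver-mono-All (All.universal p xs)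

  sumOver-cong : ∀ {f g : X → ℕ} xs → (∀ x → f x ≡ g x) → sumOver xs f ≡ sumOver xs g
  sumOver-cong []       p = refl
  sumOver-cong (x ∷ xs) p = cong₂ _+_ (p x) (sumOver-cong xs p)

  sumOver-+ : ∀ xs (f g : X → ℕ) → sumOver xs (λ x → f x + g x) ≡ sumOver xs f + sumOver xs g
  sumOver-+ []       f g = refl
  sumOver-+ (x ∷ xs) f g rewrite sumOver-+ xs f g =
    solve 4 (λ a b c d → a :+ b :+ (c :+ d) := a :+ c :+ (b :+ d)) refl (f x) (g x) _ _

  sumOver-const : ∀ (xs : List X) c → sumOver xs (λ _ → c) ≡ length xs * c
  sumOver-const []       c = refl
  sumOver-const (x ∷ xs) c = cong (_+_ c) (sumOver-const xs c)

  sumOver-*ˡ : ∀ c xs (f : X → ℕ) → sumOver xs (λ x → c * f x) ≡ c * sumOver xs f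
  sumOver-*ˡ c []       f = sym (*-zeroʳ c)
  sumOver-*ˡ c (x ∷ xs) f rewrite sumOver-*ˡ c xs f = sym (*-distribˡ-+ c (f x) _)

  sumOver-++ : ∀ xs ys (f : X → ℕ) → sumOver (xs ++ ys) f ≡ sumOver xs f + sumOver ys f
  sumOver-++ xs ys f rewrite map-++ f xs ys = sum-++ (map f xs) (map f ys)

  sumOver-large-term : ∀ xs (f : X → ℕ) c → 0 < length xs → length xs * c ≤ sumOver xs f → ∃[ x ] c ≤ f x
  sumOver-large-term (x ∷ xs) f c _ h with c ≤? f x
  ... | yes p = x , p
  sumOver-large-term (x ∷ []) f c _ h | no ¬p =
    contradiction (subst₂ _≤_ (+-identityʳ c) (+-identityʳ (f x)) h) ¬p
  sumOver-large-term (x ∷ xs@(_ ∷ _)) f c _ h | no ¬p =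
    sumOver-large-term xs f c z<s
      (+-cancelˡ-≤ c _ _ (≤-trans h (+-monoˡ-≤ _ (<⇒≤ (≰⇒> ¬p)))))

sumOver-swap : ∀ {X Y : Set} xs ys (f : X → Y → ℕ) →
  sumOver xs (λ x → sumOver ys (f x)) ≡ sumOver ys (λ y → sumOver xs (λ x → f x y))
sumOver-swap []       ys f = sym (trans (sumOver-const ys 0) (*-zeroʳ (length ys)))
sumOver-swap (x ∷ xs) ys f rewrite sumOver-swap xs ys f =
  sym (sumOver-+ ys (f x) (λ y → sumOver xs (λ x → f x y)))

sumOver-cartesianProductWith : ∀ {X Y Z : Set} (g : X → Y → Z) xs ys (f : Z → ℕ) →
  sumOver (cartesianProductWith g xs ys) f ≡ sumOver xs (λ x → sumOver ys (λ y → f (g x y)))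
sumOver-cartesianProductWith g []       ys f = refl
sumOver-cartesianProductWith g (x ∷ xs) ys f = begin
  sumOver (map (g x) ys ++ cartesianProductWith g xs ys) f
    ≡⟨ sumOver-++ (map (g x) ys) _ f ⟩
  sumOver (map (g x) ys) f + sumOver (cartesianProductWith g xs ys) f
    ≡⟨ cong₂ _+_ (cong sum (sym (map-∘ ys))) (sumOver-cartesianProductWith g xs ys f) ⟩
  sumOver ys (λ y → f (g x y)) + sumOver xs (λ x → sumOver ys (λ y → f (g x y))) ∎
  where open ≡-Reasoning

-- Deterministic programs

data Prog (w : ℕ) (R : Set) : Set where
  rd  : Address → (Word w → Prog w R) → Prog w R
  wr  : Address → Word w → Prog w R → Prog w R
  ret : R → Prog w R

Region : Set
Region = Address → Bool

∅ : Region
∅ _ = false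

assign : Bool → Address → Region → Region
assign v a S b with a ≟ b
... | yes _ = v
... | no  _ = S b

𝟙 : Bool → ℕ
𝟙 true  = 1
𝟙 false = 0

justs : {X : Set} → List (Maybe X) → ℕ
justs []             = 0
justs (just _ ∷ xs)  = suc (justs xs)
justs (nothing ∷ xs) = justs xs

module _ {w : ℕ} where

  private
    put : Memory w → Address → Word w → Memory w
    put = store {w}

  _>>=_ : ∀ {R R′} → Prog w R → (R → Prog w R′) → Prog w R′
  rd a k   >>= Q = rd a (λ v → k v >>= Q)
  wr a v P >>= Q = wr a v (P >>= Q)
  ret r    >>= Q = Q r

  module _ {R : Set} where

    res : Prog w R → Memory w → R
    res (rd a k)   m = res (k (m a)) m
    res (wr a v P) m = res P (put m a v)
    res (ret r)    m = r

    final : Prog w R → Memory w → Memory w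
    final (rd a k)   m = final (k (m a)) m
    final (wr a v P) m = final P (put m a v)
    final (ret r)    m = m

    cost : Prog w R → Memory w → ℕ
    cost (rd a k)   m = suc (cost (k (m a)) m)
    cost (wr a v P) m = suc (cost P (put m a v))
    cost (ret r)    m = 0

    written : Prog w R → Memory w → Region → Region
    written (rd a k)   m S = written (k (m a)) m S
    written (wr a v P) m S = written P (put m a v) (assign true a S)
    written (ret r)    m S = S

    -- Started from `∅`, this counts the reads whose cell was last written inside the program
    -- itself, which are all the reads that a block and the blocks within it may claim.
    hits : Prog w R → Memory w → Region → ℕ
    hits (rd a k)   m S = 𝟙 (S a) + hits (k (m a)) m S
    hits (wr a v P) m S = hits P (put m a v) (assign true a S)
    hits (ret r)    m S = 0

    -- One entry per probe: the content of each cell read in S that the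
    -- program has not overwritten before.
    transcript : Prog w R → Memory w → Region → List (Maybe (Word w))
    transcript (rd a k)   m S = (if S a then just (m a) else nothing) ∷ transcript (k (m a)) m S
    transcript (wr a v P) m S = nothing ∷ transcript P (put m a v) (assign false a S)
    transcript (ret r)    m S = []

    length-transcript : ∀ P m S → length (transcript P m S) ≡ cost P m
    length-transcript (rd a k)   m S = cong suc (length-transcript (k (m a)) m S)
    length-transcript (wr a v P) m S = cong suc (length-transcript P _ _)
    length-transcript (ret r)    m S = refl

    hits≤cost : ∀ P m S → hits P m S ≤ cost P m
    hits≤cost (rd a k)   m S with S a
    ... | true  = s≤s (hits≤cost (k (m a)) m S)
    ... | false = m≤n⇒m≤1+n (hits≤cost (k (m a)) m S)
    hits≤cost (wr a v P) m S = m≤n⇒m≤1+n (hits≤cost P _ _)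
    hits≤cost (ret r)    m S = z≤n

    -- D are the cells written by the first of two programs only, N those
    -- written by the second one, and F all of them.
    hits-split : ∀ P m (D N F : Region) → (∀ a → 𝟙 (D a) + 𝟙 (N a) ≤ 𝟙 (F a)) →
      justs (transcript P m D) + hits P m N ≤ hits P m F
    hits-split (rd a k) m D N F h with D a | N a | F a | h a
    ... | true  | false | true  | _ = s≤s (hits-split (k (m a)) m D N F h)
    ... | false | false | true  | _ = m≤n⇒m≤1+n (hits-split (k (m a)) m D N F h)
    ... | false | false | false | _ = hits-split (k (m a)) m D N F h
    ... | false | true  | true  | _ = ≤-trans (≤-reflexive (+-suc _ _)) (s≤s (hits-split (k (m a)) m D N F h))
    ... | true  | true  | true  | s≤s ()
    hits-split (wr a v P) m D N F h = hits-split P _ _ _ _ h′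
      where
      -- A write moves its cell from `D` to `N`, so no later read of it is counted on both sides.
      h′ : ∀ b → 𝟙 (assign false a D b) + 𝟙 (assign true a N b) ≤ 𝟙 (assign true a F b)
      h′ b with a ≟ b
      ... | yes _ = s≤s z≤n
      ... | no  _ = h b
    hits-split (ret r)    m D N F h = z≤n

    written-monotone : ∀ P m S a → S a ≡ true → written P m S a ≡ true
    written-monotone (rd b k)   m S a h = written-monotone (k (m b)) m S a h
    written-monotone (wr b v P) m S a h = written-monotone P _ _ a h′
      where
      h′ : assign true b S a ≡ true
      h′ with b ≟ a
      ... | yes _ = refl
      ... | no  _ = h
    written-monotone (ret r)    m S a h = h

    final-unwritten : ∀ P m S a → written P m S a ≡ false → final P m a ≡ m a
    final-unwritten (rd b k)   m S a h = final-unwritten (k (m b)) m S a h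
    final-unwritten (wr b v P) m S a h = trans (final-unwritten P _ _ a h) same
      where
      unwritten : assign true b S a ≡ false
      unwritten with assign true b S a in eq
      ... | false = refl
      ... | true with () ← trans (sym h) (written-monotone P _ _ a eq)
      same : put m b v a ≡ m a
      same with b ≟ a | unwritten
      ... | no _ | _ = refl
    final-unwritten (ret r)    m S a h = refl

    -- The two regions may differ, but an entry shows whether the cell just read lies in its region,
    -- so equal transcripts force `D` and `D′` to agree on every cell that matters. Such a read
    -- returns the recorded content if it is inside, and a content common to both memories if it is
    -- outside. A cell that the program overwrites leaves both regions.
    transcript-determines-res : ∀ P m m′ (D D′ : Region) →
      (∀ a → D a ≡ false → D′ a ≡ false → m a ≡ m′ a) →
      transcript P m D ≡ transcript P m′ D′ → res P m ≡ res P m′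
    transcript-determines-res (rd a k) m m′ D D′ h eq = same-read same-content (proj₂ (∷-injective eq))
      where
      same-content : m a ≡ m′ a
      same-content with D a in p | D′ a in p′ | proj₁ (∷-injective eq)
      ... | true  | true  | e = just-injective e
      ... | false | false | _ = h a p p′
      same-read : m a ≡ m′ a → transcript (k (m a)) m D ≡ transcript (k (m′ a)) m′ D′ →
                  res (k (m a)) m ≡ res (k (m′ a)) m′
      same-read e es rewrite e = transcript-determines-res (k (m′ a)) m m′ D D′ h es
    transcript-determines-res (wr a v P) m m′ D D′ h eq =
      transcript-determines-res P _ _ _ _ h′ (proj₂ (∷-injective eq))
      where
      h′ : ∀ b → assign false a D b ≡ false → assign false a D′ b ≡ false → put m a v b ≡ put m′ a v b
      h′ b with a ≟ b
      ... | yes _ = λ _ _ → refl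
      ... | no  _ = h b
    transcript-determines-res (ret r) m m′ D D′ h eq = refl

  module _ {R R′ : Set} (Q : R → Prog w R′) where

    res->>= : ∀ P m → res (P >>= Q) m ≡ res (Q (res P m)) (final P m)
    res->>= (rd a k)   m = res->>= (k (m a)) m
    res->>= (wr a v P) m = res->>= P _
    res->>= (ret r)    m = refl

    final->>= : ∀ P m → final (P >>= Q) m ≡ final (Q (res P m)) (final P m)
    final->>= (rd a k)   m = final->>= (k (m a)) m
    final->>= (wr a v P) m = final->>= P _
    final->>= (ret r)    m = refl

    cost->>= : ∀ P m → cost (P >>= Q) m ≡ cost P m + cost (Q (res P m)) (final P m)
    cost->>= (rd a k)   m = cong suc (cost->>= (k (m a)) m)
    cost->>= (wr a v P) m = cong suc (cost->>= P _)
    cost->>= (ret r)    m = refl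

    written->>= : ∀ P m S → written (P >>= Q) m S ≡ written (Q (res P m)) (final P m) (written P m S)
    written->>= (rd a k)   m S = written->>= (k (m a)) m S
    written->>= (wr a v P) m S = written->>= P _ _
    written->>= (ret r)    m S = refl

    hits->>= : ∀ P m S → hits (P >>= Q) m S ≡ hits P m S + hits (Q (res P m)) (final P m) (written P m S)
    hits->>= (rd a k)   m S rewrite hits->>= (k (m a)) m S = sym (+-assoc (𝟙 (S a)) _ _)
    hits->>= (wr a v P) m S = hits->>= P _ _
    hits->>= (ret r)    m S = refl

-- Programs for sequences of operations

module _ {n U : ℕ} where

  answer : Array n U → (o : Op n U) → Answer o
  answer A (update _ _)    = tt
  answer A (partial-sum p) = prefixSum A p

  apply : Array n U → Op n U → Array n U
  apply A (update i v)    = A [ i ]≔ v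
  apply A (partial-sum _) = A

  after : Array n U → List (Op n U) → Array n U
  after A []        = A
  after A (o ∷ ops) = after (apply A o) ops

  answers-∷ : ∀ A o ops → answers A (o ∷ ops) ≡ answer A o ∷ answers (apply A o) ops
  answers-∷ A (update _ _)    ops = refl
  answers-∷ A (partial-sum _) ops = refl

All-∷-injective : ∀ {X : Set} {P : X → Set} {x xs} {p p′ : P x} {ps ps′ : All P xs} →
  _≡_ {A = All P (x ∷ xs)} (p ∷ ps) (p′ ∷ ps′) → p ≡ p′ × ps ≡ ps′
All-∷-injective refl = refl , refl

-- The ℕ is the number of operations performed before: each has coins of its own.
Structure : ℕ → ℕ → ℕ → Set
Structure n U w = ℕ → (o : Op n U) → Prog w (Answer o)

module _ {n U w : ℕ} where

  shift : ℕ → Structure n U w → Structure n U w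
  shift j β i = β (j + i)

  program : Structure n U w → (ops : List (Op n U)) → Prog w (All Answer ops)
  program β []        = ret []
  program β (o ∷ ops) = β 0 o >>= λ r → program (shift 1 β) ops >>= λ rs → ret (r ∷ rs)

  Correct : Structure n U w → List (Op n U) → Memory w → Array n U → Set
  Correct β ops m A = res (program β ops) m ≡ answers A ops

  module _ (β : Structure n U w) (o : Op n U) (ops : List (Op n U)) (m : Memory w) where

    private
      R = res (β 0 o) m
      m₁ = final (β 0 o) m
      Q : (r : Answer o) → Prog w (All Answer (o ∷ ops))
      Q r = program (shift 1 β) ops >>= λ rs → ret (r ∷ rs)

    res-program-∷ : res (program β (o ∷ ops)) m ≡ R ∷ res (program (shift 1 β) ops) m₁
    res-program-∷ = trans (res->>= Q (β 0 o) m) (res->>= (λ rs → ret (R ∷ rs)) (program (shift 1 β) ops) m₁)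

    final-program-∷ : final (program β (o ∷ ops)) m ≡ final (program (shift 1 β) ops) m₁
    final-program-∷ = trans (final->>= Q (β 0 o) m) (final->>= (λ rs → ret (R ∷ rs)) (program (shift 1 β) ops) m₁)

    cost-program-∷ : cost (program β (o ∷ ops)) m ≡ cost (β 0 o) m + cost (program (shift 1 β) ops) m₁
    cost-program-∷ = trans (cost->>= Q (β 0 o) m) (cong (_+_ (cost (β 0 o) m))
      (trans (cost->>= (λ rs → ret (R ∷ rs)) (program (shift 1 β) ops) m₁) (+-identityʳ _)))

    written-program-∷ : ∀ S → written (program β (o ∷ ops)) m S ≡
                              written (program (shift 1 β) ops) m₁ (written (β 0 o) m S)
    written-program-∷ S = trans (written->>= Q (β 0 o) m S)
      (written->>= (λ rs → ret (R ∷ rs)) (program (shift 1 β) ops) m₁ _)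

    hits-program-∷ : ∀ S → hits (program β (o ∷ ops)) m S ≡
                           hits (β 0 o) m S + hits (program (shift 1 β) ops) m₁ (written (β 0 o) m S)
    hits-program-∷ S = trans (hits->>= Q (β 0 o) m S) (cong (_+_ (hits (β 0 o) m S))
      (trans (hits->>= (λ rs → ret (R ∷ rs)) (program (shift 1 β) ops) m₁ _) (+-identityʳ _)))

  Correct-∷ : ∀ β o ops {m A} → Correct β (o ∷ ops) m A →
    res (β 0 o) m ≡ answer A o × Correct (shift 1 β) ops (final (β 0 o) m) (apply A o)
  Correct-∷ β o ops {m} {A} c =
    All-∷-injective (trans (sym (res-program-∷ β o ops m)) (trans c (answers-∷ A o ops)))

  Correct-++ˡ : ∀ β xs {ys m A} → Correct β (xs ++ ys) m A → Correct β xs m A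
  Correct-++ˡ β []       c = refl
  Correct-++ˡ β (o ∷ xs) {ys} {m} {A} c with Correct-∷ β o (xs ++ ys) c
  ... | e , c′ = trans (res-program-∷ β o xs m)
                 (trans (cong₂ _∷_ e (Correct-++ˡ (shift 1 β) xs c′)) (sym (answers-∷ A o xs)))

  Correct-++ʳ : ∀ β xs {ys m A j} → length xs ≡ j → Correct β (xs ++ ys) m A →
    Correct (shift j β) ys (final (program β xs) m) (after A xs)
  Correct-++ʳ β []       refl c = c
  Correct-++ʳ β (o ∷ xs) {ys} {m} {A} refl c rewrite final-program-∷ β o xs m =
    Correct-++ʳ (shift 1 β) xs refl (proj₂ (Correct-∷ β o (xs ++ ys) c))

  cost-program-++ : ∀ β xs {ys j} m → length xs ≡ j →
    cost (program β (xs ++ ys)) m ≡ cost (program β xs) m + cost (program (shift j β) ys) (final (program β xs) m)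
  cost-program-++ β []       m refl = refl
  cost-program-++ β (o ∷ xs) {ys} m refl
    rewrite cost-program-∷ β o (xs ++ ys) m | cost-program-∷ β o xs m | final-program-∷ β o xs m
          | cost-program-++ (shift 1 β) xs {ys} (final (β 0 o) m) refl = sym (+-assoc (cost (β 0 o) m) _ _)

  hits-program-++ : ∀ β xs {ys j} m S → length xs ≡ j →
    hits (program β (xs ++ ys)) m S ≡
    hits (program β xs) m S + hits (program (shift j β) ys) (final (program β xs) m) (written (program β xs) m S)
  hits-program-++ β []       m S refl = refl
  hits-program-++ β (o ∷ xs) {ys} m S refl
    rewrite hits-program-∷ β o (xs ++ ys) m S | hits-program-∷ β o xs m S | final-program-∷ β o xs m
          | written-program-∷ β o xs m S
          | hits-program-++ (shift 1 β) xs {ys} (final (β 0 o) m) (written (β 0 o) m S) refl =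
    sym (+-assoc (hits (β 0 o) m S) _ _)

-- Families of operation sequences

data Skeleton (n U : ℕ) : Set where
  pair  : Fin n → Skeleton n U
  fixed : List (Op n U) → Skeleton n U
  _▸_   : Skeleton n U → Skeleton n U → Skeleton n U

infixr 5 _▸_

module _ {n U : ℕ} where

  Values : Skeleton n U → Set
  Values (pair i)    = Fin (suc U)
  Values (fixed ops) = ⊤
  Values (a ▸ b)     = Values a × Values b

  instantiate : ∀ s → Values s → List (Op n U)
  instantiate (pair i)    v       = update i v ∷ partial-sum i ∷ []
  instantiate (fixed ops) _       = ops
  instantiate (a ▸ b)     (x , y) = instantiate a x ++ instantiate b y

  -- The number of operations does not depend on the values. Hence the operations of a right half
  -- have the same coins whatever the values of the left half are, and the simulated program is the
  -- same in all runs that are compared.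
  size : Skeleton n U → ℕ
  size (pair i)    = 2
  size (fixed ops) = length ops
  size (a ▸ b)     = size a + size b

  length-instantiate : ∀ s x → length (instantiate s x) ≡ size s
  length-instantiate (pair i)    v       = refl
  length-instantiate (fixed ops) _       = refl
  length-instantiate (a ▸ b)     (x , y) = trans (length-++ (instantiate a x))
    (cong₂ _+_ (length-instantiate a x) (length-instantiate b y))

  zeros : ∀ s → Values s
  zeros (pair i)    = zero
  zeros (fixed ops) = tt
  zeros (a ▸ b)     = zeros a , zeros b

  allValues : ∀ s → List (Values s)
  allValues (pair i)    = allFin (suc U)
  allValues (fixed ops) = tt ∷ []
  allValues (a ▸ b)     = cartesianProduct (allValues a) (allValues b)

  allValues-unique : ∀ s → Unique (allValues s)
  allValues-unique (pair i)    = Unique.allFin⁺ (suc U)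
  allValues-unique (fixed ops) = [] ∷ []
  allValues-unique (a ▸ b)     = Unique.cartesianProduct⁺ (allValues-unique a) (allValues-unique b)

  card : Skeleton n U → ℕ
  card s = length (allValues s)

  card-▸ : ∀ a b → card (a ▸ b) ≡ card a * card b
  card-▸ a b = length-cartesianProductWith _,_ (allValues a) (allValues b)

  card>0 : ∀ s → 0 < card s
  card>0 (pair i)    = s≤s z≤n
  card>0 (fixed ops) = s≤s z≤n
  card>0 (a ▸ b)     rewrite card-▸ a b = *-mono-< (card>0 a) (card>0 b)

-- Charges and their additivity over the two halves of a block

exceeds : ℕ → ℕ → ℕ
exceeds M c with M <? c
... | yes _ = 1
... | no  _ = 0

exceeds-mono : ∀ M {c c′} → c ≤ c′ → exceeds M c ≤ exceeds M c′
exceeds-mono M {c} {c′} c≤c′ with M <? c | M <? c′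
... | yes M<c | no M≮c′ with () ← M≮c′ (≤-trans M<c c≤c′)
... | yes _   | yes _   = ≤-refl
... | no _    | _       = z≤n

-- Removes the penalty at the very end: a run of more than `M ≥ B` probes covers `B` by its own
-- cost.
*-exceeds : ∀ {B M} c → B ≤ M → B * exceeds M c ≤ c
*-exceeds {B} {M} c B≤M with M <? c
... | yes M<c rewrite *-identityʳ B = ≤-trans B≤M (<⇒≤ M<c)
... | no  _   rewrite *-zeroʳ B = z≤n

module _ {n U w : ℕ} where

  Good : Structure n U w → Skeleton n U → Memory w → Array n U → Set
  Good β s m A = ∀ x → Correct β (instantiate s x) m A

  mid : Structure n U w → (a : Skeleton n U) → Memory w → Values a → Memory w
  mid β a m x = final (program β (instantiate a x)) m

  transferred : Structure n U w → (a : Skeleton n U) → Memory w → Values a → Region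
  transferred β a m x = written (program β (instantiate a x)) m ∅

  Good-▸ˡ : ∀ {β a b m A} → Good β (a ▸ b) m A → Good β a m A
  Good-▸ˡ {β} {a} {b} g x = Correct-++ˡ β (instantiate a x) (g (x , zeros b))

  Good-▸ʳ : ∀ {β a b m A} → Good β (a ▸ b) m A → ∀ x →
    Good (shift (size a) β) b (mid β a m x) (after A (instantiate a x))
  Good-▸ʳ {β} {a} {b} g x y = Correct-++ʳ β (instantiate a x) (length-instantiate a x) (g (x , y))

module _ {n U w : ℕ} (M : ℕ) where

  -- A transcript position is described by a number up to M; longer runs are
  -- charged B instead.
  charge : ℕ → Structure n U w → (s : Skeleton n U) → Memory w → Values s → ℕ
  charge B β s m x = hits (program β (instantiate s x)) m ∅ + B * exceeds M (cost (program β (instantiate s x)) m)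

  -- An average charge of at least `B / 2`; the factor 2 is lost because up to half of the values
  -- may have sparse transcripts.
  Bound : ℕ → Structure n U w → Skeleton n U → Memory w → Set
  Bound B β s m = B * card s ≤ 2 * sumOver (allValues s) (charge B β s m)

  module _ (β : Structure n U w) (a b : Skeleton n U) (m : Memory w) where

    private
      Pb : (y : Values b) → Prog w (All Answer (instantiate b y))
      Pb y = program (shift (size a) β) (instantiate b y)

    transfer : ℕ → Values a → Values b → ℕ
    transfer S x y = justs (transcript (Pb y) (mid β a m x) (transferred β a m x)) + S * exceeds M (cost (Pb y) (mid β a m x))

    -- The reads inside `a`, those inside `b` and those in `b` of a cell last written in `a` are
    -- disjoint sets of reads inside `a ▸ b`. The penalties add up as well, since the whole run
    -- exceeds `M` whenever one half does.
    charge-▸ : ∀ Ba Bb S x y →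
      charge Ba β a m x + charge Bb (shift (size a) β) b (mid β a m x) y + transfer S x y
        ≤ charge (Ba + Bb + S) β (a ▸ b) m (x , y)
    charge-▸ Ba Bb S x y = begin
      ha + Ba * exceeds M ca + (hb + Bb * exceeds M cb) + (tb + S * exceeds M cb)
        ≤⟨ +-mono-≤ (+-mono-≤ (+-monoʳ-≤ ha (*-monoʳ-≤ Ba (exceeds-mono M ca≤c)))
             (+-monoʳ-≤ hb (*-monoʳ-≤ Bb (exceeds-mono M cb≤c)))) (+-monoʳ-≤ tb (*-monoʳ-≤ S (exceeds-mono M cb≤c))) ⟩
      ha + Ba * e + (hb + Bb * e) + (tb + S * e)
        ≡⟨ solve 7 (λ ha hb tb Ba Bb S e → ha :+ Ba :* e :+ (hb :+ Bb :* e) :+ (tb :+ S :* e)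
             := ha :+ (tb :+ hb) :+ (Ba :+ Bb :+ S) :* e) refl ha hb tb Ba Bb S e ⟩
      ha + (tb + hb) + (Ba + Bb + S) * e
        ≤⟨ +-monoˡ-≤ _ (+-monoʳ-≤ ha (hits-split (Pb y) (mid β a m x) (transferred β a m x) ∅ (transferred β a m x)
             (λ a → ≤-reflexive (+-identityʳ _)))) ⟩
      ha + hits (Pb y) (mid β a m x) (transferred β a m x) + (Ba + Bb + S) * e
        ≡⟨ cong (_+ (Ba + Bb + S) * e) (hits-program-++ β (instantiate a x) m ∅ len) ⟨
      charge (Ba + Bb + S) β (a ▸ b) m (x , y) ∎
      where
      open ≤-Reasoning
      len = length-instantiate a x
      ha = hits (program β (instantiate a x)) m ∅
      hb = hits (Pb y) (mid β a m x) ∅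
      tb = justs (transcript (Pb y) (mid β a m x) (transferred β a m x))
      ca = cost (program β (instantiate a x)) m
      cb = cost (Pb y) (mid β a m x)
      c = cost (program β (instantiate a x ++ instantiate b y)) m
      e = exceeds M c
      c≡ : c ≡ ca + cb
      c≡ = cost-program-++ β (instantiate a x) m len
      ca≤c : ca ≤ c
      ca≤c = ≤-trans (m≤m+n ca cb) (≤-reflexive (sym c≡))
      cb≤c : cb ≤ c
      cb≤c = ≤-trans (m≤n+m cb ca) (≤-reflexive (sym c≡))

    -- The three contributions are averaged separately: the left one does not involve `y`, the right
    -- one is bounded for each fixed `x`, and the transfer for each fixed `y`. Exchanging the order
    -- of summation brings them together.
    Bound-▸ : ∀ {Ba Bb} S → Bound Ba β a m → (∀ x → Bound Bb (shift (size a) β) b (mid β a m x)) →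
      (∀ y → S * card a ≤ 2 * sumOver (allValues a) (λ x → transfer S x y)) →
      Bound (Ba + Bb + S) β (a ▸ b) m
    Bound-▸ {Ba} {Bb} S ba bb tr = begin
      (Ba + Bb + S) * card (a ▸ b)
        ≡⟨ cong ((Ba + Bb + S) *_) (card-▸ a b) ⟩
      (Ba + Bb + S) * (card a * card b)
        ≡⟨ solve 5 (λ x y z k l → (x :+ y :+ z) :* (k :* l) := l :* (x :* k) :+ k :* (y :* l) :+ l :* (z :* k)) refl Ba Bb S (card a) (card b) ⟩
      card b * (Ba * card a) + card a * (Bb * card b) + card b * (S * card a)
        ≤⟨ +-mono-≤ (+-mono-≤ (*-monoʳ-≤ (card b) ba) sum-b) sum-t ⟩
      card b * (2 * sumOver (allValues a) fa) + 2 * sumOver (allValues a) (λ x → sumOver (allValues b) (fb x))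
        + 2 * sumOver (allValues a) (λ x → sumOver (allValues b) (transfer S x))
        ≡⟨ solve 4 (λ k u v w → k :* (con 2 :* u) :+ con 2 :* v :+ con 2 :* w := con 2 :* (k :* u :+ v :+ w)) refl (card b) _ _ _ ⟩
      2 * (card b * sumOver (allValues a) fa + sumOver (allValues a) (λ x → sumOver (allValues b) (fb x))
        + sumOver (allValues a) (λ x → sumOver (allValues b) (transfer S x)))
        ≡⟨ cong (2 *_) collect ⟨
      2 * sumOver (allValues a) (λ x → sumOver (allValues b) (λ y → fa x + fb x y + transfer S x y))
        ≤⟨ *-monoʳ-≤ 2 (sumOver-mono (allValues a) (λ x → sumOver-mono (allValues b) (charge-▸ Ba Bb S x))) ⟩
      2 * sumOver (allValues a) (λ x → sumOver (allValues b) (λ y → charge (Ba + Bb + S) β (a ▸ b) m (x , y)))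
        ≡⟨ cong (2 *_) (sumOver-cartesianProductWith _,_ (allValues a) (allValues b) _) ⟨
      2 * sumOver (allValues (a ▸ b)) (charge (Ba + Bb + S) β (a ▸ b) m) ∎
      where
      open ≤-Reasoning
      fa = charge Ba β a m
      fb = λ x → charge Bb (shift (size a) β) b (mid β a m x)

      sum-b : card a * (Bb * card b) ≤ 2 * sumOver (allValues a) (λ x → sumOver (allValues b) (fb x))
      sum-b = begin
        card a * (Bb * card b)
          ≡⟨ sumOver-const (allValues a) _ ⟨
        sumOver (allValues a) (λ _ → Bb * card b)
          ≤⟨ sumOver-mono (allValues a) bb ⟩
        sumOver (allValues a) (λ x → 2 * sumOver (allValues b) (fb x))
          ≡⟨ sumOver-*ˡ 2 (allValues a) _ ⟩
        2 * sumOver (allValues a) (λ x → sumOver (allValues b) (fb x)) ∎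

      sum-t : card b * (S * card a) ≤ 2 * sumOver (allValues a) (λ x → sumOver (allValues b) (transfer S x))
      sum-t = begin
        card b * (S * card a)
          ≡⟨ sumOver-const (allValues b) _ ⟨
        sumOver (allValues b) (λ _ → S * card a)
          ≤⟨ sumOver-mono (allValues b) tr ⟩
        sumOver (allValues b) (λ y → 2 * sumOver (allValues a) (λ x → transfer S x y))
          ≡⟨ sumOver-*ˡ 2 (allValues b) _ ⟩
        2 * sumOver (allValues b) (λ y → sumOver (allValues a) (λ x → transfer S x y))
          ≡⟨ cong (2 *_) (sumOver-swap (allValues a) (allValues b) (transfer S)) ⟨
        2 * sumOver (allValues a) (λ x → sumOver (allValues b) (transfer S x)) ∎

      collect : sumOver (allValues a) (λ x → sumOver (allValues b) (λ y → fa x + fb x y + transfer S x y)) ≡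
                card b * sumOver (allValues a) fa + sumOver (allValues a) (λ x → sumOver (allValues b) (fb x))
                  + sumOver (allValues a) (λ x → sumOver (allValues b) (transfer S x))
      collect = trans (sumOver-cong (allValues a) λ x →
          trans (sumOver-+ (allValues b) (λ y → fa x + fb x y) (transfer S x))
                (cong₂ _+_ (trans (sumOver-+ (allValues b) (λ _ → fa x) (fb x))
                                  (cong₂ _+_ (sumOver-const (allValues b) (fa x)) refl)) refl))
        (trans (sumOver-+ (allValues a) (λ x → card b * fa x + sumOver (allValues b) (fb x)) _)
               (cong₂ _+_ (trans (sumOver-+ (allValues a) (λ x → card b * fa x) _)
                                 (cong₂ _+_ (sumOver-*ˡ (card b) (allValues a) fa) refl)) refl))

-- Counting sparse transcripts

unique-⊆-length : ∀ {X : Set} {xs ys : List X} → Unique xs → (∀ {x} → x ∈ xs → x ∈ ys) → length xs ≤ length ys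
unique-⊆-length []         sub = z≤n
unique-⊆-length {X} {xs = x ∷ xs} (x∉xs ∷ u) sub with ∈-∃++ (sub (here refl))
... | us , vs , refl = begin
  suc (length xs)             ≤⟨ s≤s (unique-⊆-length u sub′) ⟩
  suc (length (us ++ vs))     ≡⟨ cong suc (length-++ us) ⟩
  suc (length us + length vs) ≡⟨ +-suc (length us) (length vs) ⟨
  length us + length (x ∷ vs) ≡⟨ length-++ us ⟨
  length (us ++ x ∷ vs)       ∎
  where
  open ≤-Reasoning
  sub′ : ∀ {y} → y ∈ xs → y ∈ us ++ vs
  sub′ y∈xs with ∈-++⁻ us (sub (there y∈xs))
  ... | inj₁ y∈us           = ∈-++⁺ˡ y∈us
  ... | inj₂ (here refl)    = contradiction refl (All.lookup x∉xs y∈xs)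
  ... | inj₂ (there y∈vs)   = ∈-++⁺ʳ us y∈vs

module _ {X : Set} {P : X → Set} (P? : Decidable P) where

  length-filter-sumOver : ∀ xs → length (filter P? xs) ≡ sumOver xs (λ x → 𝟙 (does (P? x)))
  length-filter-sumOver []       = refl
  length-filter-sumOver (x ∷ xs) with does (P? x)
  ... | true  = cong suc (length-filter-sumOver xs)
  ... | false = length-filter-sumOver xs

module _ {W : ℕ} where

  sparseLists : ℕ → ℕ → List (List (Maybe (Fin W)))
  sparseLists zero    S       = [] ∷ []
  sparseLists (suc M) zero    = [] ∷ map (nothing ∷_) (sparseLists M zero)
  sparseLists (suc M) (suc S) = [] ∷ map (nothing ∷_) (sparseLists M (suc S))
    ++ cartesianProductWith (λ v l → just v ∷ l) (allFin W) (sparseLists M S)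

  ∈-sparseLists : ∀ M S l → length l ≤ M → justs l ≤ S → l ∈ sparseLists M S
  ∈-sparseLists zero    S       []            _         _         = here refl
  ∈-sparseLists (suc M) zero    []            _         _         = here refl
  ∈-sparseLists (suc M) zero    (nothing ∷ l) (s≤s len) js        =
    there (∈-map⁺ (nothing ∷_) (∈-sparseLists M zero l len js))
  ∈-sparseLists (suc M) (suc S) []            _         _         = here refl
  ∈-sparseLists (suc M) (suc S) (nothing ∷ l) (s≤s len) js        =
    there (∈-++⁺ˡ (∈-map⁺ (nothing ∷_) (∈-sparseLists M (suc S) l len js)))
  ∈-sparseLists (suc M) (suc S) (just v ∷ l)  (s≤s len) (s≤s js)  =
    there (∈-++⁺ʳ (map (nothing ∷_) (sparseLists M (suc S)))
      (∈-cartesianProductWith⁺ (λ v l → just v ∷ l) (∈-allFin v) (∈-sparseLists M S l len js)))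

  length-sparseLists : ∀ M S → length (sparseLists M S) ≤ suc M * suc (M * W) ^ S
  length-sparseLists zero    S       rewrite ^-zeroˡ S = ≤-refl
  length-sparseLists (suc M) zero    =
    s≤s (≤-trans (≤-reflexive (length-map (nothing ∷_) (sparseLists M zero))) (length-sparseLists M zero))
  length-sparseLists (suc M) (suc S) = begin
    suc (length (map (nothing ∷_) (sparseLists M (suc S)) ++ cartesianProductWith (λ v l → just v ∷ l) (allFin W) (sparseLists M S)))
      ≡⟨ cong suc (length-++ (map (nothing ∷_) (sparseLists M (suc S)))) ⟩
    suc (length (map (nothing ∷_) (sparseLists M (suc S))) + length (cartesianProductWith (λ v l → just v ∷ l) (allFin W) (sparseLists M S)))
      ≡⟨ cong suc (cong₂ _+_ (length-map (nothing ∷_) (sparseLists M (suc S)))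
           (trans (length-cartesianProductWith (λ v l → just v ∷ l) (allFin W) (sparseLists M S))
                  (cong (_* length (sparseLists M S)) (length-tabulate {n = W} id)))) ⟩
    suc (length (sparseLists M (suc S)) + W * length (sparseLists M S))
      ≤⟨ s≤s (+-mono-≤ (length-sparseLists M (suc S)) (*-monoʳ-≤ W (length-sparseLists M S))) ⟩
    suc (suc M * (b * b ^ S) + W * (suc M * b ^ S))
      ≡⟨ cong suc (solve 4 (λ m b x w → m :* (b :* x) :+ w :* (m :* x) := m :* ((w :+ b) :* x)) refl (suc M) b (b ^ S) W) ⟩
    suc (suc M * ((W + b) * b ^ S))
      ≤⟨ +-mono-≤ (m^n>0 b′ (suc S)) (*-monoʳ-≤ (suc M) (*-mono-≤ (≤-reflexive (+-suc W (M * W)))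
           (^-monoˡ-≤ S (s≤s (m≤n+m (M * W) W))))) ⟩
    suc (suc M) * (b′ * b′ ^ S) ∎
    where
    open ≤-Reasoning
    b = suc (M * W)
    b′ = suc (suc M * W)

  module _ {V : Set} (M S : ℕ) (vs : List V) (τ : V → List (Maybe (Fin W)))
           (vs-unique : Unique vs) (τ-injective : ∀ {v v′} → τ v ≡ τ v′ → v ≡ v′)
           (few : 2 * (suc M * suc (M * W) ^ S) ≤ length vs) where

    private
      Sparse : V → Set
      Sparse v = length (τ v) ≤ M × justs (τ v) ≤ S

      sparse? : Decidable Sparse
      sparse? v = (length (τ v) ≤? M) ×-dec (justs (τ v) ≤? S)

      sparse# : ℕ
      sparse# = sumOver vs (λ v → 𝟙 (does (sparse? v)))

      large : V → ℕ
      large v = justs (τ v) + S * exceeds M (length (τ v))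

      sparse-few : 2 * sparse# ≤ length vs
      sparse-few = begin
        2 * sparse#                            ≡⟨ cong (2 *_) (length-filter-sumOver sparse? vs) ⟨
        2 * length (filter sparse? vs)         ≡⟨ cong (2 *_) (length-map τ (filter sparse? vs)) ⟨
        2 * length (map τ (filter sparse? vs)) ≤⟨ *-monoʳ-≤ 2 (unique-⊆-length
             (Unique.map⁺ τ-injective (Unique.filter⁺ sparse? vs-unique)) sub) ⟩
        2 * length (sparseLists M S)           ≤⟨ *-monoʳ-≤ 2 (length-sparseLists M S) ⟩
        2 * (suc M * suc (M * W) ^ S)          ≤⟨ few ⟩
        length vs                              ∎
        where
        open ≤-Reasoning
        sub : ∀ {l} → l ∈ map τ (filter sparse? vs) → l ∈ sparseLists M S
        sub l∈ with ∈-map⁻ τ l∈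
        ... | v , v∈ , refl with ∈-filter⁻ sparse? {xs = vs} v∈
        ... | _ , len , js = ∈-sparseLists M S (τ v) len js

      sparse-or-large : ∀ v → S ≤ large v + S * 𝟙 (does (sparse? v))
      sparse-or-large v with M <? length (τ v) | justs (τ v) ≤? S
      ... | yes _ | _      = ≤-trans (≤-trans (≤-reflexive (sym (*-identityʳ S))) (m≤n+m _ (justs (τ v)))) (m≤m+n _ _)
      ... | no _  | no j≰S = ≤-trans (<⇒≤ (≰⇒> j≰S)) (≤-trans (m≤m+n _ _) (m≤m+n _ _))
      ... | no M≮ | yes j≤S = ≤-trans (≤-reflexive (trans (sym (*-identityʳ S))
        (cong (λ c → S * 𝟙 c) (sym (dec-true (sparse? v) (≮⇒≥ M≮ , j≤S)))))) (m≤n+m _ _)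

    -- By injectivity and `few`, at most half of the values have a sparse transcript. Any other
    -- transcript has more than `S` entries or is longer than `M`, and in either case `large` is at
    -- least `S`.
    injective-large-average : S * length vs ≤ 2 * sumOver vs large
    injective-large-average = +-cancelʳ-≤ (S * length vs) _ _ (begin
      S * length vs + S * length vs
        ≡⟨ solve 2 (λ s l → s :* l :+ s :* l := con 2 :* (l :* s)) refl S (length vs) ⟩
      2 * (length vs * S)
        ≡⟨ cong (2 *_) (sumOver-const vs S) ⟨
      2 * sumOver vs (λ _ → S)
        ≤⟨ *-monoʳ-≤ 2 (sumOver-mono vs sparse-or-large) ⟩
      2 * sumOver vs (λ v → large v + S * 𝟙 (does (sparse? v)))
        ≡⟨ cong (2 *_) (trans (sumOver-+ vs large _) (cong (_+_ (sumOver vs large)) (sumOver-*ˡ S vs _))) ⟩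
      2 * (sumOver vs large + S * sparse#)
        ≡⟨ solve 3 (λ a s c → con 2 :* (a :+ s :* c) := con 2 :* a :+ s :* (con 2 :* c)) refl (sumOver vs large) S sparse# ⟩
      2 * sumOver vs large + S * (2 * sparse#)
        ≤⟨ +-monoʳ-≤ (2 * sumOver vs large) (*-monoʳ-≤ S sparse-few) ⟩
      2 * sumOver vs large + S * length vs ∎)
      where open ≤-Reasoning

-- Prefix sums determine array entries

prefixSum-cong : ∀ {n U} (A B : Array n U) q →
  (∀ j → toℕ j ≤ toℕ q → lookup A j ≡ lookup B j) → prefixSum A q ≡ prefixSum B q
prefixSum-cong (x ∷ A) (y ∷ B) zero    h = cong (λ v → toℕ v + 0) (h zero z≤n)
prefixSum-cong (x ∷ A) (y ∷ B) (suc q) h =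
  cong₂ _+_ (cong toℕ (h zero z≤n)) (prefixSum-cong A B q (λ j j≤q → h (suc j) (s≤s j≤q)))

prefixSum-determines : ∀ {n U} (A B : Array n U) p q → toℕ p ≤ toℕ q →
  (∀ j → toℕ j ≤ toℕ q → j ≢ p → lookup A j ≡ lookup B j) →
  prefixSum A q ≡ prefixSum B q → lookup A p ≡ lookup B p
prefixSum-determines (x ∷ A) (y ∷ B) zero    zero    _         h eq =
  toℕ-injective (+-cancelʳ-≡ 0 (toℕ x) (toℕ y) eq)
prefixSum-determines (x ∷ A) (y ∷ B) zero    (suc q) _         h eq =
  toℕ-injective (+-cancelʳ-≡ (prefixSum B q) (toℕ x) (toℕ y)
    (trans (cong (_+_ (toℕ x)) (sym (prefixSum-cong A B q λ j j≤q → h (suc j) (s≤s j≤q) λ ()))) eq))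
prefixSum-determines (x ∷ A) (y ∷ B) (suc p) (suc q) (s≤s p≤q) h eq =
  prefixSum-determines A B p q p≤q (λ j j≤q j≢p → h (suc j) (s≤s j≤q) (j≢p ∘ Fin.suc-injective))
    (+-cancelˡ-≡ (toℕ x) _ _ (trans eq (cong (λ v → toℕ v + prefixSum B q) (sym (h zero z≤n λ ())))))

module _ {n U : ℕ} where

  Avoids : Fin n → Op n U → Set
  Avoids p (update i _)    = i ≢ p
  Avoids p (partial-sum _) = ⊤

  lookup-after-avoids : ∀ {p} (A : Array n U) {ops} → All (Avoids p) ops → lookup (after A ops) p ≡ lookup A p
  lookup-after-avoids A []                              = refl
  lookup-after-avoids A {update i v ∷ ops}    (i≢p ∷ h) =
    trans (lookup-after-avoids _ h) (lookup∘update′ (i≢p ∘ sym) A v)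
  lookup-after-avoids A {partial-sum _ ∷ ops} (_ ∷ h)   = lookup-after-avoids A h

  lookup-after-cong : ∀ {p} (A B : Array n U) ops → lookup A p ≡ lookup B p →
    lookup (after A ops) p ≡ lookup (after B ops) p
  lookup-after-cong     A B []                    h = h
  lookup-after-cong {p} A B (update i v ∷ ops)    h = lookup-after-cong _ _ ops h′
    where
    h′ : lookup (apply A (update i v)) p ≡ lookup (apply B (update i v)) p
    h′ with p Fin.≟ i
    ... | yes refl = trans (lookup∘update i A v) (sym (lookup∘update i B v))
    ... | no  p≢i  = trans (lookup∘update′ p≢i A v) (trans h (sym (lookup∘update′ p≢i B v)))
  lookup-after-cong     A B (partial-sum _ ∷ ops) h = lookup-after-cong A B ops h

  after-++ : ∀ (A : Array n U) xs ys → after A (xs ++ ys) ≡ after (after A xs) ys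
  after-++ A []       ys = refl
  after-++ A (o ∷ xs) ys = after-++ (apply A o) xs ys

  answers-query : ∀ (A B : Array n U) pre q post →
    answers A (pre ++ partial-sum q ∷ post) ≡ answers B (pre ++ partial-sum q ∷ post) →
    prefixSum (after A pre) q ≡ prefixSum (after B pre) q
  answers-query A B []        q post eq = proj₁ (All-∷-injective eq)
  answers-query A B (o ∷ pre) q post eq = answers-query _ _ pre q post (proj₂ (All-∷-injective
    (trans (sym (answers-∷ A o _)) (trans eq (answers-∷ B o _)))))

^-distribʳ-* : ∀ k m n → (m * n) ^ k ≡ m ^ k * n ^ k
^-distribʳ-* zero    m n = refl
^-distribʳ-* (suc k) m n = trans (cong (m * n *_) (^-distribʳ-* k m n)) ([m*n]*[o*p]≡[m*o]*[n*p] m n (m ^ k) (n ^ k))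

-- Interleaved blocks

half : ∀ d {j} → j < 2 ^ suc d → Σ[ i ∈ ℕ ] i < 2 ^ d × (j ≡ 2 * i ⊎ j ≡ suc (2 * i))
half d {j} j<2^d = i , i<2^d , half-of
  where
  split : ∀ j → Σ[ i ∈ ℕ ] (j ≡ 2 * i ⊎ j ≡ suc (2 * i))
  split zero    = 0 , inj₁ refl
  split (suc j) with split j
  ... | i , inj₁ e = i , inj₂ (cong suc e)
  ... | i , inj₂ e = suc i , inj₁ (trans (cong suc e) (sym (*-suc 2 i)))
  i = proj₁ (split j)
  half-of = proj₂ (split j)
  2i≤j : j ≡ 2 * i ⊎ j ≡ suc (2 * i) → 2 * i ≤ j
  2i≤j (inj₁ e) = ≤-reflexive (sym e)
  2i≤j (inj₂ e) = ≤-trans (n≤1+n _) (≤-reflexive (sym e))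
  i<2^d : i < 2 ^ d
  i<2^d = *-cancelˡ-< 2 i (2 ^ d) (≤-<-trans (2i≤j half-of) j<2^d)

odd<double : ∀ {i m} → i < m → suc (2 * i) < 2 * m
odd<double {i} {m} i<m = ≤-trans (≤-reflexive (sym (*-suc 2 i))) (*-monoʳ-≤ 2 i<m)

even<double : ∀ {i m} → i < m → 2 * i < 2 * m
even<double = *-monoʳ-< 2

module _ {n : ℕ} where

  evens odds : (ℕ → Fin n) → ℕ → Fin n
  evens f j = f (2 * j)
  odds  f j = f (suc (2 * j))

  Increasing : ℕ → (ℕ → Fin n) → Set
  Increasing d f = ∀ {i j} → i < j → j < 2 ^ d → toℕ (f i) < toℕ (f j)

  Increasing-evens : ∀ d {f} → Increasing (suc d) f → Increasing d (evens f)
  Increasing-evens d inc i<j j< = inc (even<double i<j) (even<double j<)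

  Increasing-odds : ∀ d {f} → Increasing (suc d) f → Increasing d (odds f)
  Increasing-odds d inc i<j j< = inc (s≤s (even<double i<j)) (odd<double j<)

  Increasing-injective : ∀ d {f i j} → Increasing d f → i < 2 ^ d → j < 2 ^ d → f i ≡ f j → i ≡ j
  Increasing-injective d {f} {i} {j} inc i< j< eq with <-cmp i j
  ... | tri< i<j _ _ = contradiction (cong toℕ eq) (<⇒≢ (inc i<j j<))
  ... | tri≈ _ e _   = e
  ... | tri> _ _ j<i = contradiction (cong toℕ (sym eq)) (<⇒≢ (inc j<i i<))

  even≢odd-index : ∀ d {f i j} → Increasing (suc d) f → i < 2 ^ d → j < 2 ^ d → evens f i ≢ odds f j
  even≢odd-index d {f} {i} {j} inc i< j< eq =
    even≢odd i j (Increasing-injective (suc d) inc (even<double i<) (odd<double j<) eq)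

  inBlock? : ∀ d (f : ℕ → Fin n) p → (Σ[ j ∈ ℕ ] j < 2 ^ d × f j ≡ p) ⊎ (∀ {j} → j < 2 ^ d → f j ≢ p)
  inBlock? d f p with anyUpTo? (λ j → f j Fin.≟ p) (2 ^ d)
  ... | yes h = inj₁ h
  ... | no ¬h = inj₂ (λ j< e → ¬h (_ , j< , e))

module _ {n U : ℕ} where

  block : ℕ → (ℕ → Fin n) → Skeleton n U
  block zero    f = pair (f 0)
  block (suc d) f = block d (evens f) ▸ block d (odds f)

  block-avoids : ∀ d f {p} x → (∀ {j} → j < 2 ^ d → f j ≢ p) → All (Avoids p) (instantiate (block d f) x)
  block-avoids zero    f x       h = h z<s ∷ tt ∷ []
  block-avoids (suc d) f (x , y) h =
    All.++⁺ (block-avoids d (evens f) x (h ∘ even<double)) (block-avoids d (odds f) y (h ∘ odd<double))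

  block-query : ∀ d f x {j} → j < 2 ^ d → partial-sum (f j) ∈ instantiate (block d f) x
  block-query zero    f x       (s≤s z≤n) = there (here refl)
  block-query (suc d) f (x , y) j< with half d j<
  ... | i , i< , inj₁ refl = ∈-++⁺ˡ (block-query d (evens f) x i<)
  ... | i , i< , inj₂ refl = ∈-++⁺ʳ (instantiate (block d (evens f)) x) (block-query d (odds f) y i<)

  -- Each position of the block is updated exactly once, so the chosen value is still there at the
  -- end, whatever the initial arrays `A` and `B` were.
  values-determined : ∀ d f → Increasing d f → ∀ (A B : Array n U) x x′ →
    (∀ {j} → j < 2 ^ d → lookup (after A (instantiate (block d f) x)) (f j) ≡
                         lookup (after B (instantiate (block d f) x′)) (f j)) → x ≡ x′
  values-determined zero    f inc A B x x′ h =
    trans (sym (lookup∘update (f 0) A x)) (trans (h z<s) (lookup∘update (f 0) B x′))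
  values-determined (suc d) f inc A B (x , y) (x′ , y′) h = cong₂ _,_ x≡x′ y≡y′
    where
    xs = instantiate (block d (evens f)) x
    ys = instantiate (block d (odds f)) y
    xs′ = instantiate (block d (evens f)) x′
    ys′ = instantiate (block d (odds f)) y′
    h′ : ∀ {j} → j < 2 ^ suc d → lookup (after (after A xs) ys) (f j) ≡ lookup (after (after B xs′) ys′) (f j)
    h′ j< = subst₂ (λ a b → lookup a _ ≡ lookup b _) (after-++ A xs ys) (after-++ B xs′ ys′) (h j<)
    avoids : ∀ {j} z → j < 2 ^ d → All (Avoids (evens f j)) (instantiate (block d (odds f)) z)
    avoids z j< = block-avoids d (odds f) z (λ i< → even≢odd-index d inc j< i< ∘ sym)
    y≡y′ : y ≡ y′
    y≡y′ = values-determined d (odds f) (Increasing-odds d inc) (after A xs) (after B xs′) y y′ (h′ ∘ odd<double)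
    x≡x′ : x ≡ x′
    x≡x′ = values-determined d (evens f) (Increasing-evens d inc) A B x x′ λ j< →
      trans (sym (lookup-after-avoids (after A xs) (avoids y j<)))
        (trans (h′ (even<double j<)) (lookup-after-avoids (after B xs′) (avoids y′ j<)))

  -- The query at an odd index sees exactly one unknown entry beyond those
  -- determined at smaller positions.
  answers-determine-values : ∀ d f → Increasing (suc d) f → ∀ (A : Array n U) x x′ y →
    let a = block d (evens f) ; ys = instantiate (block d (odds f)) y in
    answers (after A (instantiate a x)) ys ≡ answers (after A (instantiate a x′)) ys → x ≡ x′
  answers-determine-values d f inc A x x′ y eq =
    values-determined d (evens f) (Increasing-evens d inc) A A x x′ (λ _ → agree _)
    where
    ys = instantiate (block d (odds f)) y
    B = after A (instantiate (block d (evens f)) x)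
    C = after A (instantiate (block d (evens f)) x′)

    Agree : Fin n → Set
    Agree p = lookup B p ≡ lookup C p

    agree-outside : ∀ {p} → (∀ {j} → j < 2 ^ d → evens f j ≢ p) → Agree p
    agree-outside h = trans (lookup-after-avoids A (block-avoids d (evens f) x h))
                            (sym (lookup-after-avoids A (block-avoids d (evens f) x′ h)))

    step : ∀ k → (∀ {k′} → k′ < k → ∀ p → toℕ p ≡ k′ → Agree p) → ∀ p → toℕ p ≡ k → Agree p
    step k rec p refl with inBlock? d (evens f) p
    ... | inj₂ h            = agree-outside h
    ... | inj₁ (j , j< , refl) with ∈-∃++ (block-query d (odds f) y j<)
    ... | pre , post , ys≡ =
      -- The entry at `p` is compared at the moment of the query at `q`: the operations `pre` before
      -- it belong to the odd half and leave `p` alone.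
      trans (sym (lookup-after-avoids B avoids))
        (trans (prefixSum-determines (after B pre) (after C pre) p q (<⇒≤ p<q)
                 (λ i i≤q i≢p → lookup-after-cong B C pre (agree-below i i≤q i≢p))
                 (answers-query B C pre q post (subst (λ zs → answers B zs ≡ answers C zs) ys≡ eq)))
          (lookup-after-avoids C avoids))
      where
      q = odds f j
      p<q : toℕ p < toℕ q
      p<q = inc ≤-refl (odd<double j<)
      avoids : All (Avoids p) pre
      avoids = All.++⁻ˡ pre (subst (All (Avoids p)) ys≡
        (block-avoids d (odds f) y (λ i< → even≢odd-index d inc j< i< ∘ sym)))
      agree-below : ∀ i → toℕ i ≤ toℕ q → i ≢ p → Agree i
      agree-below i i≤q i≢p with toℕ i <? toℕ p
      ... | yes i<p = rec i<p i refl
      -- No even index lies strictly between `2 * j` and the queried `suc (2 * j)`, so an entry in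
      -- this gap was not touched by the even half.
      ... | no  i≮p = agree-outside λ {j′} j′< e → between j′ j′< e
        where
        between : ∀ j′ → j′ < 2 ^ d → evens f j′ ≢ i
        between j′ j′< refl with <-cmp j j′
        ... | tri< j<j′ _ _ = <⇒≱ (inc (odd<double j<j′) (even<double j′<)) i≤q
        ... | tri≈ _ refl _ = i≢p refl
        ... | tri> _ _ j′<j = i≮p (inc (even<double j′<j) (even<double j<))

    agree : ∀ p → Agree p
    agree p = <-rec (λ k → ∀ p → toℕ p ≡ k → Agree p) step (toℕ p) p refl

  card-block : ∀ d f → card (block d f) ≡ suc U ^ (2 ^ d)
  card-block zero    f = trans (length-tabulate {n = suc U} id) (sym (*-identityʳ (suc U)))
  card-block (suc d) f = begin
    card (block d (evens f) ▸ block d (odds f))           ≡⟨ card-▸ (block d (evens f)) (block d (odds f)) ⟩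
    card (block d (evens f)) * card (block d (odds f))    ≡⟨ cong₂ _*_ (card-block d (evens f)) (card-block d (odds f)) ⟩
    suc U ^ (2 ^ d) * suc U ^ (2 ^ d)                     ≡⟨ ^-distribˡ-+-* (suc U) (2 ^ d) (2 ^ d) ⟨
    suc U ^ (2 ^ d + 2 ^ d)                               ≡⟨ cong (λ k → suc U ^ (2 ^ d + k)) (+-identityʳ (2 ^ d)) ⟨
    suc U ^ (2 ^ suc d)                                   ∎
    where open ≡-Reasoning

-- Summed thresholds of the blocks inside one with 2^(j+g) positions: a node
-- with halves of 2^(i+g) positions contributes 2^i.
budget : ℕ → ℕ
budget zero    = 0
budget (suc j) = budget j + budget j + 2 ^ j

-- Lower bound for a single block

module _ {n U w : ℕ} where

  -- A cell in neither transferred region still has its content from `m`, the memory before the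
  -- block, so the two memories agree there. Equal transcripts therefore give equal answers in the
  -- odd half; these are the correct ones and determine the values of the even half.
  transcript-injective : ∀ d f → Increasing (suc d) f → ∀ {β : Structure n U w} {m A} →
    let a = block d (evens f) ; b = block d (odds f) in
    Good β (a ▸ b) m A → ∀ {x x′} y →
    let P = program (shift (size a) β) (instantiate b y) in
    transcript P (mid β a m x) (transferred β a m x) ≡
    transcript P (mid β a m x′) (transferred β a m x′) → x ≡ x′
  transcript-injective d f inc {β} {m} {A} good {x} {x′} y eq =
    answers-determine-values d f inc A x x′ y
      (trans (sym (Good-▸ʳ good x y)) (trans
        (transcript-determines-res (program (shift (size a) β) (instantiate b y)) _ _ _ _ untouched eq)
        (Good-▸ʳ good x′ y)))
    where
    a = block d (evens f)
    b = block d (odds f)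
    untouched : ∀ c → transferred β a m x c ≡ false → transferred β a m x′ c ≡ false →
                mid β a m x c ≡ mid β a m x′ c
    untouched c h h′ = trans (final-unwritten (program β (instantiate a x)) m ∅ c h)
                        (sym (final-unwritten (program β (instantiate a x′)) m ∅ c h′))

module _ {n U w : ℕ} (M g : ℕ) (few : 2 * (suc M * suc (M * 2 ^ w)) ≤ suc U ^ (2 ^ g)) where

  -- The hypothesis `few` weighs one transcript entry against `2 ^ g` values. Its `2 ^ j`-th power
  -- weighs `2 ^ j` entries against `2 ^ (j + g)` values; raising the factor `2 * suc M` along with
  -- the rest only enlarges the left side.
  few-sparse : ∀ j f → 2 * (suc M * suc (M * 2 ^ w) ^ (2 ^ j)) ≤ card (block {n} {U} (j + g) f)
  few-sparse j f = begin
    2 * (suc M * suc (M * 2 ^ w) ^ (2 ^ j))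
      ≡⟨ *-assoc 2 (suc M) _ ⟨
    2 * suc M * suc (M * 2 ^ w) ^ (2 ^ j)
      ≤⟨ *-monoˡ-≤ (suc (M * 2 ^ w) ^ (2 ^ j)) (m≤m^n (2 * suc M) (m^n>0 2 j)) ⟩
    (2 * suc M) ^ (2 ^ j) * suc (M * 2 ^ w) ^ (2 ^ j)
      ≡⟨ ^-distribʳ-* (2 ^ j) (2 * suc M) (suc (M * 2 ^ w)) ⟨
    (2 * suc M * suc (M * 2 ^ w)) ^ (2 ^ j)
      ≡⟨ cong (_^ (2 ^ j)) (*-assoc 2 (suc M) (suc (M * 2 ^ w))) ⟩
    (2 * (suc M * suc (M * 2 ^ w))) ^ (2 ^ j)
      ≤⟨ ^-monoˡ-≤ (2 ^ j) few ⟩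
    (suc U ^ (2 ^ g)) ^ (2 ^ j)
      ≡⟨ ^-*-assoc (suc U) (2 ^ g) (2 ^ j) ⟩
    suc U ^ (2 ^ g * 2 ^ j)
      ≡⟨ cong (suc U ^_) (trans (sym (^-distribˡ-+-* 2 g j)) (cong (2 ^_) (+-comm g j))) ⟩
    suc U ^ (2 ^ (j + g))
      ≡⟨ card-block (j + g) f ⟨
    card (block (j + g) f) ∎
    where
    open ≤-Reasoning
    m≤m^n : ∀ k .{{_ : NonZero k}} {e} → 0 < e → k ≤ k ^ e
    m≤m^n k {suc e} _ = ≤-trans (≤-reflexive (sym (*-identityʳ k))) (*-monoʳ-≤ k (m^n>0 k e))

  Bound-block : ∀ j f → Increasing (j + g) f → ∀ {β : Structure n U w} {m A} →
    Good β (block (j + g) f) m A → Bound M (budget j) β (block (j + g) f) m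
  -- Blocks of `2 ^ g` positions claim nothing: this is where the lowest g levels are given up.
  Bound-block zero    f inc good = z≤n
  Bound-block (suc j) f inc {β} {m} good =
    Bound-▸ M β a b m {budget j} {budget j} (2 ^ j)
      (Bound-block j (evens f) (Increasing-evens (j + g) inc) (Good-▸ˡ {b = b} good))
      (λ x → Bound-block j (odds f) (Increasing-odds (j + g) inc) (Good-▸ʳ good x))
      λ y → subst (λ s → 2 ^ j * card a ≤ 2 * s)
        (sumOver-cong (allValues a) λ x →
          cong (λ l → justs (τ y x) + 2 ^ j * exceeds M l) (length-transcript (P y) _ _))
        (injective-large-average M (2 ^ j) (allValues a) (τ y) (allValues-unique a)
          (transcript-injective (j + g) f inc good y) (few-sparse j (evens f)))
    where
    a = block (j + g) (evens f)
    b = block (j + g) (odds f)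
    P = λ y → program (shift (size a) β) (instantiate b y)
    τ = λ y x → transcript (P y) (mid β a m x) (transferred β a m x)

-- Epochs

sumTo : ℕ → (ℕ → ℕ) → ℕ
sumTo zero    h = 0
sumTo (suc m) h = sumTo m h + h m

sumTo-double : ∀ m h → sumTo (2 * m) h ≡ sumTo m (λ j → h (2 * j)) + sumTo m (λ j → h (suc (2 * j)))
sumTo-double zero    h = refl
sumTo-double (suc m) h = trans (cong (λ k → sumTo k h) (*-suc 2 m))
  (trans (cong (λ s → s + h (2 * m) + h (suc (2 * m))) (sumTo-double m h))
    (solve 4 (λ a b c d → a :+ b :+ c :+ d := a :+ c :+ (b :+ d)) refl
      (sumTo m (λ j → h (2 * j))) (sumTo m (λ j → h (suc (2 * j)))) (h (2 * m)) (h (suc (2 * m)))))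

module _ {n : ℕ} .{{_ : NonZero n}} where

  -- The remainder makes this total on ℕ, as `block` expects; only arguments below `n` matter.
  position : ℕ → Fin n
  position j = j mod n

  toℕ-position : ∀ {j} → j < n → toℕ (position j) ≡ j
  toℕ-position {j} j<n = trans (toℕ-fromℕ< (m%n<n j n)) (m<n⇒m%n≡m j<n)

  position-increasing : ∀ d → 2 ^ d ≤ n → Increasing d position
  position-increasing d 2^d≤n i<j j<2^d
    rewrite toℕ-position (<-≤-trans j<2^d 2^d≤n) | toℕ-position (<-trans i<j (<-≤-trans j<2^d 2^d≤n)) = i<j

  occurs : Fin n → ℕ → ℕ
  occurs i j = occurrences i (position j ∷ [])

  occurs-here : ∀ i → occurs i (toℕ i) ≡ 1
  occurs-here i = cong length (filter-accept (i Fin.≟_) {xs = []} (sym (toℕ-injective (toℕ-position (Fin.toℕ<n i)))))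

  occurs-elsewhere : ∀ i {j} → j < n → toℕ i ≢ j → occurs i j ≡ 0
  occurs-elsewhere i j<n i≢j =
    cong length (filter-reject (i Fin.≟_) {xs = []} λ e → i≢j (trans (cong toℕ e) (toℕ-position j<n)))

  occurs-once : ∀ i m → m ≤ n → (m ≤ toℕ i → sumTo m (occurs i) ≡ 0) × (toℕ i < m → sumTo m (occurs i) ≡ 1)
  occurs-once i zero    _   = (λ _ → refl) , λ ()
  occurs-once i (suc m) m<n with occurs-once i m (<⇒≤ m<n)
  ... | before , found = before′ , found′
    where
    before′ : m < toℕ i → sumTo m (occurs i) + occurs i m ≡ 0
    before′ m<i = cong₂ _+_ (before (<⇒≤ m<i)) (occurs-elsewhere i m<n (>⇒≢ m<i))
    found′ : toℕ i < suc m → sumTo m (occurs i) + occurs i m ≡ 1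
    found′ (s≤s i≤m) with m≤n⇒m<n∨m≡n i≤m
    ... | inj₁ i<m  = cong₂ _+_ (found i<m) (occurs-elsewhere i m<n (<⇒≢ i<m))
    ... | inj₂ refl = cong₂ _+_ (before ≤-refl) (occurs-here i)

  module _ {U : ℕ} where

    -- An epoch has to treat all `n` positions. Those outside the block receive the constant 0, and
    -- their operations claim no probes.
    filler : ℕ → ℕ → List (Op n U)
    filler k zero    = []
    filler k (suc r) = filler k r ++ update (position (k + r)) zero ∷ partial-sum (position (k + r)) ∷ []

    epoch : ℕ → Skeleton n U
    epoch d = block d position ▸ fixed (filler (2 ^ d) (n ∸ 2 ^ d))

    module _ (index : Op n U → Maybe (Fin n))
             (index-pair : ∀ p v → mapMaybe index (update p v ∷ partial-sum p ∷ []) ≡ p ∷ []) (i : Fin n) where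

      private
        count : List (Op n U) → ℕ
        count ops = occurrences i (mapMaybe index ops)

        count-++ : ∀ xs ys → count (xs ++ ys) ≡ count xs + count ys
        count-++ xs ys rewrite mapMaybe-++ index xs ys | filter-++ (i Fin.≟_) (mapMaybe index xs) (mapMaybe index ys) =
          length-++ (filter (i Fin.≟_) (mapMaybe index xs))

        count-block : ∀ d f x → count (instantiate (block d f) x) ≡ sumTo (2 ^ d) (λ j → occurrences i (f j ∷ []))
        count-block zero    f v       = cong (occurrences i) (index-pair (f 0) v)
        count-block (suc d) f (x , y) = trans (count-++ (instantiate (block d (evens f)) x) _)
          (trans (cong₂ _+_ (count-block d (evens f) x) (count-block d (odds f) y))
            (sym (sumTo-double (2 ^ d) (λ j → occurrences i (f j ∷ [])))))

        count-filler : ∀ k r → sumTo k (occurs i) + count (filler k r) ≡ sumTo (k + r) (occurs i)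
        count-filler k zero    = trans (+-identityʳ _) (cong (λ m → sumTo m (occurs i)) (sym (+-identityʳ k)))
        count-filler k (suc r) rewrite +-suc k r =
          trans (cong (_+_ (sumTo k (occurs i))) (trans (count-++ (filler k r) _)
                  (cong (_+_ (count (filler k r))) (cong (occurrences i) (index-pair (position (k + r)) zero)))))
            (trans (sym (+-assoc (sumTo k (occurs i)) _ _)) (cong (_+ occurs i (k + r)) (count-filler k r)))

      -- Serves for updates and queries alike, because an update and the query at the same position
      -- always come as a pair that contributes this position once to either count.
      epoch-count : ∀ d → 2 ^ d ≤ n → ∀ x → occurrences i (mapMaybe index (instantiate (epoch d) x)) ≡ 1
      epoch-count d 2^d≤n (x , _) = begin
        count (instantiate (block d position) x ++ filler (2 ^ d) (n ∸ 2 ^ d))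
          ≡⟨ count-++ (instantiate (block d position) x) _ ⟩
        count (instantiate (block d position) x) + count (filler (2 ^ d) (n ∸ 2 ^ d))
          ≡⟨ cong (_+ count (filler (2 ^ d) (n ∸ 2 ^ d))) (count-block d position x) ⟩
        sumTo (2 ^ d) (occurs i) + count (filler (2 ^ d) (n ∸ 2 ^ d))
          ≡⟨ count-filler (2 ^ d) (n ∸ 2 ^ d) ⟩
        sumTo (2 ^ d + (n ∸ 2 ^ d)) (occurs i)
          ≡⟨ cong (λ m → sumTo m (occurs i)) (m+[n∸m]≡n 2^d≤n) ⟩
        sumTo n (occurs i)
          ≡⟨ proj₂ (occurs-once i n ≤-refl) (Fin.toℕ<n i) ⟩
        1 ∎
        where open ≡-Reasoning

    epoch-isEpoch : ∀ d → 2 ^ d ≤ n → ∀ x → IsEpoch (instantiate (epoch d) x)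
    epoch-isEpoch d 2^d≤n x = (λ i → epoch-count updateIndex (λ _ _ → refl) i d 2^d≤n x)
                            , (λ i → epoch-count queryIndex (λ _ _ → refl) i d 2^d≤n x)

    length-filler : ∀ k r → length (filler k r) ≡ 2 * r
    length-filler k zero    = refl
    length-filler k (suc r) = trans (length-++ (filler k r))
      (trans (cong (_+ 2) (length-filler k r)) (trans (+-comm (2 * r) 2) (sym (*-suc 2 r))))

    size-block : ∀ d f → size (block {n} {U} d f) ≡ 2 * 2 ^ d
    size-block zero    f = refl
    size-block (suc d) f rewrite size-block d (evens f) | size-block d (odds f) =
      solve 1 (λ k → con 2 :* k :+ con 2 :* k := con 2 :* (con 2 :* k)) refl (2 ^ d)

    size-epoch : ∀ d → 2 ^ d ≤ n → size (epoch d) ≡ 2 * n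
    size-epoch d 2^d≤n rewrite size-block d position | length-filler (2 ^ d) (n ∸ 2 ^ d) =
      trans (sym (*-distribˡ-+ 2 (2 ^ d) (n ∸ 2 ^ d))) (cong (2 *_) (m+[n∸m]≡n 2^d≤n))

module _ {n U : ℕ} where

  repeated : ℕ → Skeleton n U → Skeleton n U
  repeated zero    s = fixed []
  repeated (suc E) s = s ▸ repeated E s

  size-repeated : ∀ E s → size (repeated E s) ≡ E * size s
  size-repeated zero    s = refl
  size-repeated (suc E) s = cong (_+_ (size s)) (size-repeated E s)

  repeated-epochBased : ∀ E s → (∀ x → IsEpoch (instantiate s x)) → ∀ x → EpochBased E (instantiate (repeated E s) x)
  repeated-epochBased zero    s isEpoch _       = [] , refl , [] , refl
  repeated-epochBased (suc E) s isEpoch (x , y) with repeated-epochBased E s isEpoch y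
  ... | epochs , len , alls , eq =
    instantiate s x ∷ epochs , cong suc len , isEpoch x ∷ alls , cong (instantiate s x ++_) eq

-- Deterministic lower bound for a sequence of epochs

module _ {n U w : ℕ} (M : ℕ) where

  -- Threshold 0 for the transfer: nothing is claimed for reads in `b` of cells last written in `a`.
  -- This suffices between epochs, where plain addition already yields the factor `E`.
  Bound-▸-disjoint : ∀ {Ba Bb} (β : Structure n U w) (a b : Skeleton n U) (m : Memory w) → Bound M Ba β a m →
    (∀ x → Bound M Bb (shift (size a) β) b (mid β a m x)) → Bound M (Ba + Bb) β (a ▸ b) m
  Bound-▸-disjoint {Ba} {Bb} β a b m ba bb =
    subst (λ B → Bound M B β (a ▸ b) m) (+-identityʳ (Ba + Bb)) (Bound-▸ M β a b m {Ba} {Bb} 0 ba bb (λ _ → z≤n))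

  Bound-repeated : ∀ {B} s → (∀ {β : Structure n U w} {m A} → Good β s m A → Bound M B β s m) →
    ∀ E {β : Structure n U w} {m A} → Good β (repeated E s) m A → Bound M (E * B) β (repeated E s) m
  Bound-repeated {B} s bound zero    good = z≤n
  Bound-repeated {B} s bound (suc E) {β} {m} good =
    Bound-▸-disjoint {B} {E * B} β s (repeated E s) m (bound (Good-▸ˡ {b = repeated E s} good))
      (λ x → Bound-repeated s bound E (Good-▸ʳ good x))

  -- One factor 2 comes from `Bound`. The other arises because the reads and the penalty in a charge
  -- are each bounded by the full cost of the run.
  deterministic-bound : .{{_ : NonZero n}} → ∀ j g E →
    2 * (suc M * suc (M * 2 ^ w)) ≤ suc U ^ (2 ^ g) → 2 ^ (j + g) ≤ n → E * budget j ≤ M →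
    ∀ {β : Structure n U w} {m A} → let s = repeated E (epoch (j + g)) in Good β s m A →
    E * budget j * card s ≤ 4 * sumOver (allValues s) (λ x → cost (program β (instantiate s x)) m)
  deterministic-bound j g E few 2^d≤n B≤M {β} {m} good = begin
    E * budget j * card s
      ≤⟨ Bound-repeated (epoch (j + g)) bound-epoch E good ⟩
    2 * sumOver (allValues s) (charge M (E * budget j) β s m)
      ≤⟨ *-monoʳ-≤ 2 (sumOver-mono (allValues s) λ x →
           +-mono-≤ (hits≤cost (program β (instantiate s x)) m ∅)
             (≤-trans (*-exceeds (c x) B≤M) (≤-reflexive (sym (+-identityʳ (c x)))))) ⟩
    2 * sumOver (allValues s) (λ x → 2 * c x)
      ≡⟨ cong (2 *_) (sumOver-*ˡ 2 (allValues s) c) ⟩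
    2 * (2 * sumOver (allValues s) c)
      ≡⟨ *-assoc 2 2 (sumOver (allValues s) c) ⟨
    4 * sumOver (allValues s) c ∎
    where
    open ≤-Reasoning
    s = repeated E (epoch (j + g))
    c = λ x → cost (program β (instantiate s x)) m
    bound-epoch : ∀ {β : Structure n U w} {m A} → Good β (epoch (j + g)) m A → Bound M (budget j) β (epoch (j + g)) m
    bound-epoch {β} {m} good = subst (λ B → Bound M B β (epoch (j + g)) m) (+-identityʳ (budget j))
      (Bound-▸-disjoint {budget j} {0} β (block (j + g) position) b m
        (Bound-block M g few j position (position-increasing (j + g) 2^d≤n) (Good-▸ˡ {b = b} good))
        λ _ → z≤n)
      where b = fixed (filler (2 ^ (j + g)) (n ∸ 2 ^ (j + g)))

-- Fixing the coins

module _ {w k : ℕ} {R : Set} (next : List (Response w) → Action w R) (tape : Tape → Vec Bool k) (r₀ : R) where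

  -- Exceeding the limits of the truncation yields the junk result r₀.
  mutual
    compile : ℕ → List (Response w) → Prog w R
    compile zero       h = ret r₀
    compile (suc fuel) h = compileAction fuel h (next h)

    compileAction : ℕ → List (Response w) → Action w R → Prog w R
    compileAction fuel h (read a)    = rd a (λ v → compile fuel (word v ∷ h))
    compileAction fuel h (write a v) = wr a v (compile fuel (ack ∷ h))
    compileAction fuel h (coin t j)  = compileToss fuel h (bitAt (tape t) j)
    compileAction fuel h (return r)  = ret r

    compileToss : ℕ → List (Response w) → Maybe Bool → Prog w R
    compileToss fuel h (just b) = compile fuel (bit b ∷ h)
    compileToss fuel h nothing  = ret r₀

  Computes : Prog w R → Memory w → ℕ → R × Memory w → Set
  Computes P m c (r , m′) = cost P m ≡ c × res P m ≡ r × final P m ≡ m′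

  mutual
    -- Only executions that return within the limits are matched, so the junk result never enters:
    -- the lower bound is applied only to coins for which every sequence of the family halts.
    exec-compile : ∀ fuel h m {c y} → exec next tape fuel h m ≡ (c , just y) → Computes (compile fuel h) m c y
    exec-compile (suc fuel) h m eq = perform-compile fuel h m (next h) eq

    perform-compile : ∀ fuel h m a {c y} → perform next tape fuel h m a ≡ (c , just y) →
                      Computes (compileAction fuel h a) m c y
    perform-compile fuel h m (read a) eq with exec next tape fuel (word (m a) ∷ h) m in e
    perform-compile fuel h m (read a) refl | _ with exec-compile fuel (word (m a) ∷ h) m e
    ... | ec , er = cong suc ec , er
    perform-compile fuel h m (write a v) eq with exec next tape fuel (ack ∷ h) (store {w} m a v) in e
    perform-compile fuel h m (write a v) refl | _ with exec-compile fuel (ack ∷ h) (store {w} m a v) e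
    ... | ec , er = cong suc ec , er
    perform-compile fuel h m (coin t j)  eq = toss-compile fuel h m (bitAt (tape t) j) eq
    perform-compile fuel h m (return r)  refl = refl , refl , refl

    toss-compile : ∀ fuel h m b {c y} → toss next tape fuel h m b ≡ (c , just y) →
                   Computes (compileToss fuel h b) m c y
    toss-compile fuel h m (just b) eq = exec-compile fuel (bit b ∷ h) m eq

module _ {w k k′ : ℕ} {R : Set} (next : List (Response w) → Action w R)
         (tape : Tape → Vec Bool k) (tape′ : Tape → Vec Bool k′)
         (extends : ∀ t j {b} → bitAt (tape t) j ≡ just b → bitAt (tape′ t) j ≡ just b) where

  mutual
    -- An execution that has returned never asked for a missing bit, so longer tapes and more fuel
    -- reproduce it action by action.
    exec-extend : ∀ fuel h m {c y} → exec next tape fuel h m ≡ (c , just y) →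
                  exec next tape′ (suc fuel) h m ≡ (c , just y)
    exec-extend (suc fuel) h m eq = perform-extend fuel h m (next h) eq

    perform-extend : ∀ fuel h m a {c y} → perform next tape fuel h m a ≡ (c , just y) →
                     perform next tape′ (suc fuel) h m a ≡ (c , just y)
    perform-extend fuel h m (read a) eq with exec next tape fuel (word (m a) ∷ h) m in e
    perform-extend fuel h m (read a) refl | _ = cong probe (exec-extend fuel (word (m a) ∷ h) m e)
    perform-extend fuel h m (write a v) eq with exec next tape fuel (ack ∷ h) (store {w} m a v) in e
    perform-extend fuel h m (write a v) refl | _ = cong probe (exec-extend fuel (ack ∷ h) (store {w} m a v) e)
    perform-extend fuel h m (coin t j)  eq with bitAt (tape t) j in e
    ... | just b rewrite extends t j e = exec-extend fuel (bit b ∷ h) m eq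
    perform-extend fuel h m (return r)  refl = refl

dropLast : ∀ {k} → Vec Bool (suc k) → Vec Bool k
dropLast {zero}  _       = []
dropLast {suc k} (b ∷ v) = b ∷ dropLast v

bitAt-dropLast : ∀ {k} (v : Vec Bool (suc k)) j {b} → bitAt (dropLast v) j ≡ just b → bitAt v j ≡ just b
bitAt-dropLast {suc k} (x ∷ v) zero    eq = eq
bitAt-dropLast {suc k} (x ∷ v) (suc j) eq = bitAt-dropLast v j eq

bitAt-tapes-dropLast : ∀ {k} (σ ρ : Vec Bool (suc k)) t j {b} →
  bitAt (tapes (dropLast σ) (dropLast ρ) t) j ≡ just b → bitAt (tapes σ ρ t) j ≡ just b
bitAt-tapes-dropLast σ ρ shared = bitAt-dropLast σ
bitAt-tapes-dropLast σ ρ own    = bitAt-dropLast ρ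

-- A `Structure` is indexed by all of ℕ; the constant row past the end is not reached by a sequence
-- of `T` operations.
stream : ∀ {k T} → Vec (Vec Bool k) T → ℕ → Vec Bool k
stream []       _       = Vec.replicate _ true
stream (ρ ∷ ρs) zero    = ρ
stream (ρ ∷ ρs) (suc i) = stream ρs i

module _ {n U w : ℕ} (D : Algorithm n U w) where
  open Algorithm D

  junk : (o : Op n U) → Answer o
  junk (update _ _)    = tt
  junk (partial-sum _) = 0

  structureFrom : ∀ {k T} → Vec Bool k → Vec (Vec Bool k) T → Structure n U w
  structureFrom {k} σ ρs i o = compile (next o) (tapes σ (stream ρs i)) (junk o) k []

  structure : ∀ {k T} → Coins k T → Structure n U w
  structure (σ ∷ ρs) = structureFrom σ ρs

  runFrom-program : ∀ {k} m (σ : Vec Bool k) ops ρs {c rs} → runFrom D m σ ops ρs ≡ (c , just rs) →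
    cost (program (structureFrom σ ρs) ops) m ≡ c × res (program (structureFrom σ ρs) ops) m ≡ rs
  runFrom-program m σ [] [] refl = refl , refl
  runFrom-program {k} m σ (o ∷ ops) (ρ ∷ ρs) eq with exec (next o) (tapes σ ρ) k [] m in e
  ... | c₁ , just (r , m₁) with exec-compile (next o) (tapes σ ρ) (junk o) k [] m e
  ... | ec , er , refl with runFrom D m₁ σ ops ρs in e′
  runFrom-program {k} m σ (o ∷ ops) (ρ ∷ ρs) refl | c₁ , just (r , m₁) | ec , er , refl | c₂ , just rs
    with runFrom-program m₁ σ ops ρs e′
  ... | ec′ , er′ = trans (cost-program-∷ (structureFrom σ (ρ ∷ ρs)) o ops m) (cong₂ _+_ ec ec′)
                  , trans (res-program-∷ (structureFrom σ (ρ ∷ ρs)) o ops m) (cong₂ _∷_ er er′)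

  run-program : ∀ {k} ops (ω : Coins k (length ops)) {c rs} → run D ops ω ≡ (c , just rs) →
    cost (program (structure ω) ops) initial ≡ c × res (program (structure ω) ops) initial ≡ rs
  run-program ops (σ ∷ ρs) eq = runFrom-program initial σ ops ρs eq

  runFrom-extend : ∀ {k} m (σ : Vec Bool (suc k)) ops ρs {c rs} →
    runFrom D m (dropLast σ) ops (Vec.map dropLast ρs) ≡ (c , just rs) → runFrom D m σ ops ρs ≡ (c , just rs)
  runFrom-extend m σ [] [] refl = refl
  runFrom-extend {k} m σ (o ∷ ops) (ρ ∷ ρs) eq with exec (next o) (tapes (dropLast σ) (dropLast ρ)) k [] m in e
  ... | c₁ , just (r , m₁) with runFrom D m₁ (dropLast σ) ops (Vec.map dropLast ρs) in e′
  runFrom-extend {k} m σ (o ∷ ops) (ρ ∷ ρs) refl | c₁ , just (r , m₁) | c₂ , just rs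
    rewrite exec-extend (next o) (tapes (dropLast σ) (dropLast ρ)) (tapes σ ρ) (bitAt-tapes-dropLast σ ρ) k [] m e
          | runFrom-extend m₁ σ ops ρs e′ = refl

  undefined : ∀ {k} ops → Coins k (length ops) → ℕ
  undefined ops ω = undefined# (result D ops ω)

  undefined-dropLast : ∀ {k} ops (ω : Coins (suc k) (length ops)) →
    undefined ops ω ≤ undefined ops (Vec.map dropLast ω)
  undefined-dropLast ops (σ ∷ ρs) with runFrom D initial (dropLast σ) ops (Vec.map dropLast ρs) in e
  ... | c , just rs rewrite runFrom-extend initial σ ops ρs e = z≤n
  ... | c , nothing with proj₂ (runFrom D initial σ ops ρs)
  ... | just _  = z≤n
  ... | nothing = ≤-refl

-- Sums over coins at consecutive truncation levels

bits : (k : ℕ) → List (Vec Bool k)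
bits = vectors (true ∷ false ∷ [])

sumOver-bits-dropLast : ∀ k (f : Vec Bool k → ℕ) → sumOver (bits (suc k)) (f ∘ dropLast) ≡ 2 * sumOver (bits k) f
sumOver-bits-dropLast zero    f = solve 1 (λ a → a :+ (a :+ con 0) := con 2 :* (a :+ con 0)) refl (f [])
sumOver-bits-dropLast (suc k) f = begin
  sumOver (bits (suc (suc k))) (f ∘ dropLast)
    ≡⟨ sumOver-cartesianProductWith _∷_ bs (bits (suc k)) (f ∘ dropLast) ⟩
  sumOver bs (λ b → sumOver (bits (suc k)) (λ v → f (b ∷ dropLast v)))
    ≡⟨ sumOver-cong bs (λ b → sumOver-bits-dropLast k (λ v → f (b ∷ v))) ⟩
  sumOver bs (λ b → 2 * sumOver (bits k) (λ v → f (b ∷ v)))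
    ≡⟨ sumOver-*ˡ 2 bs (λ b → sumOver (bits k) (λ v → f (b ∷ v))) ⟩
  2 * sumOver bs (λ b → sumOver (bits k) (λ v → f (b ∷ v)))
    ≡⟨ cong (2 *_) (sumOver-cartesianProductWith _∷_ bs (bits k) f) ⟨
  2 * sumOver (bits (suc k)) f ∎
  where
  open ≡-Reasoning
  bs = true ∷ false ∷ []

-- The hypothesis says that `g` is `c` to 1 from `ys` to `xs`, so applied in `T` coordinates it is
-- `c ^ T` to 1. For `dropLast` on every tape this is the ratio of the numbers of outcomes at two
-- consecutive levels.
sumOver-vectors-map : ∀ {X Y : Set} (g : Y → X) c xs ys → (∀ f → sumOver ys (f ∘ g) ≡ c * sumOver xs f) →
  ∀ T (f : Vec X T → ℕ) → sumOver (vectors ys T) (f ∘ Vec.map g) ≡ c ^ T * sumOver (vectors xs T) f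
sumOver-vectors-map g c xs ys h zero    f = sym (+-identityʳ _)
sumOver-vectors-map g c xs ys h (suc T) f = begin
  sumOver (vectors ys (suc T)) (f ∘ Vec.map g)
    ≡⟨ sumOver-cartesianProductWith _∷_ ys (vectors ys T) (f ∘ Vec.map g) ⟩
  sumOver ys (λ y → sumOver (vectors ys T) (λ v → f (g y ∷ Vec.map g v)))
    ≡⟨ sumOver-cong ys (λ y → sumOver-vectors-map g c xs ys h T (λ v → f (g y ∷ v))) ⟩
  sumOver ys (λ y → c ^ T * sumOver (vectors xs T) (λ v → f (g y ∷ v)))
    ≡⟨ sumOver-*ˡ (c ^ T) ys (λ y → sumOver (vectors xs T) (λ v → f (g y ∷ v))) ⟩
  c ^ T * sumOver ys (λ y → sumOver (vectors xs T) (λ v → f (g y ∷ v)))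
    ≡⟨ cong (c ^ T *_) (h (λ x → sumOver (vectors xs T) (λ v → f (x ∷ v)))) ⟩
  c ^ T * (c * sumOver xs (λ x → sumOver (vectors xs T) (λ v → f (x ∷ v))))
    ≡⟨ cong (λ s → c ^ T * (c * s)) (sumOver-cartesianProductWith _∷_ xs (vectors xs T) f) ⟨
  c ^ T * (c * sumOver (vectors xs (suc T)) f)
    ≡⟨ solve 3 (λ a b s → a :* (b :* s) := b :* a :* s) refl (c ^ T) c _ ⟩
  c ^ suc T * sumOver (vectors xs (suc T)) f ∎
  where open ≡-Reasoning

-- Averaging over the coins

-- Probability at most `1 / N` of not halting at level `k`, with denominators cleared.
Rarely : ∀ {n U w} → Algorithm n U w → ℕ → List (Op n U) → ℕ → Set
Rarely D N ops k = sumOver (allCoins k (length ops)) (undefined D ops) * N ≤ (2 ^ k) ^ suc (length ops)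

module _ {n U w : ℕ} (D : Algorithm n U w) (N : ℕ) where

  Rarely-suc : ∀ ops {k} → Rarely D N ops k → Rarely D N ops (suc k)
  Rarely-suc ops {k} h = begin
    sumOver (allCoins (suc k) T) (undefined D ops) * N
      ≤⟨ *-monoˡ-≤ N (sumOver-mono (allCoins (suc k) T) (undefined-dropLast D ops)) ⟩
    sumOver (allCoins (suc k) T) (undefined D ops ∘ Vec.map dropLast) * N
      ≡⟨ cong (_* N) (sumOver-vectors-map dropLast 2 (bits k) (bits (suc k)) (sumOver-bits-dropLast k) (suc T) (undefined D ops)) ⟩
    2 ^ suc T * sumOver (allCoins k T) (undefined D ops) * N
      ≡⟨ *-assoc (2 ^ suc T) _ N ⟩
    2 ^ suc T * (sumOver (allCoins k T) (undefined D ops) * N)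
      ≤⟨ *-monoʳ-≤ (2 ^ suc T) h ⟩
    2 ^ suc T * (2 ^ k) ^ suc T
      ≡⟨ ^-distribʳ-* (suc T) 2 (2 ^ k) ⟨
    (2 ^ suc k) ^ suc T ∎
    where
    open ≤-Reasoning
    T = length ops

common-level : ∀ {X : Set} (P : X → ℕ → Set) → (∀ x {k} → P x k → P x (suc k)) → (∀ x → ∃[ k ] P x k) →
  ∀ xs → ∃[ k ] All (λ x → P x k) xs
common-level P step ex []       = 0 , []
common-level P step ex (x ∷ xs) with ex x | common-level P step ex xs
... | k , p | l , ps = k + l , subst (P x) (+-comm l k) (raise l p) ∷ All.map (raise k) ps
  where
  raise : ∀ j {y k} → P y k → P y (j + k)
  raise zero    p = p
  raise (suc j) p = step _ (raise j p)

-- By `rare` the union bound leaves at most half as many failures as there are outcomes. Summed over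
-- the outcomes, the error terms thus absorb at most half of the left side; the other half is left
-- to `P`, whence 8 in place of 4, and some `x` attains the average.
averaging : ∀ {X Ω : Set} (xs : List X) (ωs : List Ω) (P u : X → Ω → ℕ) B → 0 < length xs →
  (∀ ω → B * length xs ≤ 4 * sumOver xs (λ x → P x ω) + B * length xs * sumOver xs (λ x → u x ω)) →
  (All (λ x → sumOver ωs (u x) * (2 * length xs) ≤ length ωs) xs) →
  ∃[ x ] B * length ωs ≤ 8 * sumOver ωs (P x)
averaging xs ωs P u B 0<X bound rare =
  sumOver-large-term xs _ (B * length ωs) 0<X (begin
    X * (B * Ω)
      ≤⟨ +-cancelʳ-≤ (L * Ω) (X * (B * Ω)) (8 * ΣP) main ⟩
    8 * ΣP
      ≡⟨ sumOver-*ˡ 8 xs _ ⟨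
    sumOver xs (λ x → 8 * sumOver ωs (P x)) ∎)
  where
  open ≤-Reasoning
  X = length xs
  Ω = length ωs
  L = B * X
  ΣP = sumOver xs (λ x → sumOver ωs (P x))
  Σu = sumOver xs (λ x → sumOver ωs (u x))

  rare-total : 2 * Σu ≤ Ω
  rare-total = *-cancelˡ-≤ X {{>-nonZero 0<X}} (begin
    X * (2 * Σu)
      ≡⟨ solve 2 (λ x s → x :* (con 2 :* s) := con 2 :* x :* s) refl X Σu ⟩
    2 * X * Σu
      ≡⟨ sumOver-*ˡ (2 * X) xs _ ⟨
    sumOver xs (λ x → 2 * X * sumOver ωs (u x))
      ≤⟨ sumOver-mono-All (All.map (λ {x} h → ≤-trans (≤-reflexive (*-comm (2 * X) (sumOver ωs (u x)))) h) rare) ⟩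
    sumOver xs (λ _ → Ω)
      ≡⟨ sumOver-const xs Ω ⟩
    X * Ω ∎)

  main : X * (B * Ω) + L * Ω ≤ 8 * ΣP + L * Ω
  main = begin
    X * (B * Ω) + L * Ω
      ≡⟨ solve 3 (λ x b o → x :* (b :* o) :+ b :* x :* o := con 2 :* (o :* (b :* x))) refl X B Ω ⟩
    2 * (Ω * L)
      ≡⟨ cong (2 *_) (sumOver-const ωs L) ⟨
    2 * sumOver ωs (λ _ → L)
      ≤⟨ *-monoʳ-≤ 2 (sumOver-mono ωs bound) ⟩
    2 * sumOver ωs (λ ω → 4 * sumOver xs (λ x → P x ω) + L * sumOver xs (λ x → u x ω))
      ≡⟨ cong (2 *_) (trans (sumOver-+ ωs _ _) (cong₂ _+_
           (trans (sumOver-*ˡ 4 ωs _) (cong (4 *_) (sumOver-swap ωs xs (λ ω x → P x ω))))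
           (trans (sumOver-*ˡ L ωs _) (cong (L *_) (sumOver-swap ωs xs (λ ω x → u x ω)))))) ⟩
    2 * (4 * ΣP + L * Σu)
      ≡⟨ solve 3 (λ p l v → con 2 :* (con 4 :* p :+ l :* v) := con 8 :* p :+ l :* (con 2 :* v)) refl ΣP L Σu ⟩
    8 * ΣP + L * (2 * Σu)
      ≤⟨ +-monoʳ-≤ (8 * ΣP) (*-monoʳ-≤ L rare-total) ⟩
    8 * ΣP + L * Ω ∎

-- Existence of a hard sequence in a family

∈-allValues : ∀ {n U} (s : Skeleton n U) x → x ∈ allValues s
∈-allValues (pair i)    v       = ∈-allFin v
∈-allValues (fixed ops) _       = here refl
∈-allValues (a ▸ b)     (x , y) = ∈-cartesianProduct⁺ (∈-allValues a x) (∈-allValues b y)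

∈-sumOver : ∀ {X : Set} {xs : List X} {x} (f : X → ℕ) → x ∈ xs → f x ≤ sumOver xs f
∈-sumOver f (here refl) = m≤m+n _ _
∈-sumOver f (there x∈)  = ≤-trans (∈-sumOver f x∈) (m≤n+m _ _)

sumOver-allCoins-subst : ∀ k {T T′} (e : T′ ≡ T) (f : Coins k T′ → ℕ) →
  sumOver (allCoins k T′) f ≡ sumOver (allCoins k T) (λ ω → f (subst (Coins k) (sym e) ω))
sumOver-allCoins-subst k refl f = refl

structure-subst : ∀ {n U w} (D : Algorithm n U w) {k T T′} (e : T ≡ T′) (ω : Coins k T) →
  structure D (subst (Coins k) e ω) ≡ structure D ω
structure-subst D refl ω = refl

module _ {n U w : ℕ} (D : Algorithm n U w) (A : Array n U) (s : Skeleton n U)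
         (correct : ∀ x → NeverErrs A D (instantiate s x)) (M B : ℕ)
         (bound : ∀ {β : Structure n U w} → Good β s (Algorithm.initial D) A →
           B * card s ≤ 4 * sumOver (allValues s) (λ x → cost (program β (instantiate s x)) (Algorithm.initial D)))
         where
  open Algorithm D

  private
    ops : Values s → List (Op n U)
    ops = instantiate s

    module _ {k : ℕ} where
      -- The sums over values and coins can be exchanged only if the coin space is the same for all
      -- values, whereas `length (ops x)` equals `size s` only up to a proof.
      cast : ∀ x → Coins k (size s) → Coins k (length (ops x))
      cast x = subst (Coins k) (sym (length-instantiate s x))

      P u : Values s → Coins k (size s) → ℕ
      P x ω = probes D (ops x) (cast x ω)
      u x ω = undefined D (ops x) (cast x ω)

      halting : ∀ x ω → u x ω ≡ 0 →
        cost (program (structure D ω) (ops x)) initial ≡ P x ω × Correct (structure D ω) (ops x) initial A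
      halting x ω u≡0 with run D (ops x) (cast x ω) in e
      ... | c , just rs with run-program D (ops x) (cast x ω) e
      ... | ec , er rewrite structure-subst D (sym (length-instantiate s x)) ω =
        ec , trans er (correct x k (cast x ω) rs (cong proj₂ e))

      -- If some sequence fails to halt with these coins, the error term alone covers the left side.
      -- If none fails, the compiled structure is correct on all values and the deterministic bound
      -- applies.
      per-coins : ∀ ω t → sumOver (allValues s) (λ x → u x ω) ≡ t →
        B * card s ≤ 4 * sumOver (allValues s) (λ x → P x ω) + B * card s * t
      per-coins ω (suc t) e = ≤-trans (m≤m*n (B * card s) (suc t)) (m≤n+m _ _)
      per-coins ω zero    e = ≤-trans (≤-trans (bound (λ x → proj₂ (run-x x)))
          (≤-reflexive (cong (4 *_) (sumOver-cong (allValues s) (λ x → proj₁ (run-x x)))))) (m≤m+n _ _)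
        where
        run-x = λ x → halting x ω (n≤0⇒n≡0 (≤-trans (∈-sumOver (λ x → u x ω) (∈-allValues s x)) (≤-reflexive e)))

    rare-cast : ∀ {k} x → Rarely D (2 * card s) (ops x) k →
      sumOver (allCoins k (size s)) (u x) * (2 * card s) ≤ length (allCoins k (size s))
    rare-cast {k} x h = subst₂ (λ a b → a * (2 * card s) ≤ b)
      (sumOver-allCoins-subst k (length-instantiate s x) (undefined D (ops x)))
      (trans (cong (λ T → (2 ^ k) ^ suc T) (length-instantiate s x)) (sym (length-allCoins k (size s)))) h

  hard-instance : (∀ x → ∃[ k ] Rarely D (2 * card s) (ops x) k) →
    ∃[ x ] ∃[ k ] B * (2 ^ k) ^ suc (length (ops x)) ≤ 8 * sumOver (allCoins k (length (ops x))) (probes D (ops x))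
  hard-instance halts = proj₁ hard , k , subst₂ (λ a b → B * a ≤ 8 * b)
    (trans (length-allCoins k (size s)) (cong (λ T → (2 ^ k) ^ suc T) (sym (length-instantiate s (proj₁ hard)))))
    (sym (sumOver-allCoins-subst k (length-instantiate s (proj₁ hard)) (probes D (ops (proj₁ hard))))) (proj₂ hard)
    where
    level : ∃[ k ] All (λ x → Rarely D (2 * card s) (ops x) k) (allValues s)
    level = common-level (λ x → Rarely D (2 * card s) (ops x)) (λ x {k} → Rarely-suc D (2 * card s) (ops x) {k}) halts (allValues s)
    k = proj₁ level
    hard : ∃[ x ] B * length (allCoins k (size s)) ≤ 8 * sumOver (allCoins k (size s)) (P x)
    hard = averaging (allValues s) (allCoins k (size s)) P u B (card>0 s) (λ ω → per-coins ω _ refl)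
      (All.map (λ {x} → rare-cast {k} x) (proj₂ level))

-- Arithmetic

/-cancel-≤ : ∀ a b c d .{{_ : NonZero b}} .{{_ : NonZero d}} → (+ a) ℚᵘ./ b ℚᵘ.≤ (+ c) ℚᵘ./ d → a * d ≤ c * b
/-cancel-≤ a b@(suc _) c d@(suc _) (*≤* h) = ℤ.drop‿+≤+ (subst₂ ℤ._≤_ (sym (ℤ.pos-* a d)) (sym (ℤ.pos-* c b)) h)

0<1/ : ∀ d .{{_ : NonZero d}} → 0ℚᵘ ℚᵘ.< (+ 1) ℚᵘ./ d
0<1/ (suc d) = *<* (+<+ z<s)

1/-*-≤ : ∀ k x s t .{{_ : NonZero k}} .{{_ : NonZero t}} → x * t ≤ k * s →
  (+ 1) ℚᵘ./ k ℚᵘ.* ((+ x) ℚᵘ./ 1) ℚᵘ.≤ (+ s) ℚᵘ./ t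
1/-*-≤ (suc k) x s t@(suc _) h = *≤* (subst₂ ℤ._≤_
  (trans (ℤ.pos-* x t) (cong (ℤ._* + t) (sym (ℤ.*-identityˡ (+ x)))))
  (trans (cong +_ (trans (*-comm (suc k) s) (cong (λ l → s * suc l) (sym (*-identityʳ k))))) (ℤ.pos-* s (suc (k * 1))))
  (+≤+ h))

n<2^n : ∀ n → n < 2 ^ n
n<2^n zero    = z<s
n<2^n (suc n) = +-mono-≤ (m^n>0 2 n) (≤-trans (n<2^n n) (≤-reflexive (sym (+-identityʳ (2 ^ n)))))

2^⌊log₂n⌋≤n : ∀ n → 1 ≤ n → 2 ^ ⌊log₂ n ⌋ ≤ n
2^⌊log₂n⌋≤n = <-rec (λ n → 1 ≤ n → 2 ^ ⌊log₂ n ⌋ ≤ n) step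
  where
  step : ∀ n → (∀ {m} → m < n → 1 ≤ m → 2 ^ ⌊log₂ m ⌋ ≤ m) → 1 ≤ n → 2 ^ ⌊log₂ n ⌋ ≤ n
  step 1               rec _ = ≤-refl
  step n@(suc (suc k)) rec _ = begin
    2 ^ ⌊log₂ n ⌋           ≡⟨ cong (2 ^_) (sym (m+[n∸m]≡n (⌊log₂⌋-mono-≤ {2} {n} (s≤s (s≤s z≤n))))) ⟩
    2 ^ suc (⌊log₂ n ⌋ ∸ 1) ≡⟨ cong (λ l → 2 ^ suc l) (⌊log₂⌊n/2⌋⌋≡⌊log₂n⌋∸1 n) ⟨
    2 * 2 ^ ⌊log₂ ⌊ n /2⌋ ⌋ ≤⟨ *-monoʳ-≤ 2 (rec (⌊n/2⌋<n (suc k)) (s≤s z≤n)) ⟩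
    2 * ⌊ n /2⌋             ≡⟨ cong (_+_ (⌊ n /2⌋)) (+-identityʳ ⌊ n /2⌋) ⟩
    ⌊ n /2⌋ + ⌊ n /2⌋       ≤⟨ +-monoʳ-≤ ⌊ n /2⌋ (⌊n/2⌋≤⌈n/2⌉ n) ⟩
    ⌊ n /2⌋ + ⌈ n /2⌉       ≡⟨ ⌊n/2⌋+⌈n/2⌉≡n n ⟩
    n                       ∎
    where open ≤-Reasoning

n≤2^1+⌊log₂n⌋ : ∀ n → n ≤ 2 ^ suc ⌊log₂ n ⌋
n≤2^1+⌊log₂n⌋ n = <⇒≤ (≰⇒> λ h →
  1+n≰n (≤-trans (≤-reflexive (sym (⌊log₂[2^n]⌋≡n (suc ⌊log₂ n ⌋)))) (⌊log₂⌋-mono-≤ h)))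

double-budget : ∀ j → 2 * budget j ≡ j * 2 ^ j
double-budget zero    = refl
double-budget (suc j) = begin
  2 * (budget j + budget j + 2 ^ j)   ≡⟨ solve 2 (λ b k → con 2 :* (b :+ b :+ k) := con 2 :* (con 2 :* b) :+ con 2 :* k) refl (budget j) (2 ^ j) ⟩
  2 * (2 * budget j) + 2 * 2 ^ j      ≡⟨ cong (λ s → 2 * s + 2 * 2 ^ j) (double-budget j) ⟩
  2 * (j * 2 ^ j) + 2 * 2 ^ j         ≡⟨ solve 2 (λ j k → con 2 :* (j :* k) :+ con 2 :* k := (con 1 :+ j) :* (con 2 :* k)) refl j (2 ^ j) ⟩
  suc j * 2 ^ suc j                   ∎
  where open ≡-Reasoning

budget≤2^2j : ∀ j → budget j ≤ 2 ^ (2 * j)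
budget≤2^2j j = begin
  budget j        ≤⟨ m≤n*m (budget j) 2 ⟩
  2 * budget j    ≡⟨ double-budget j ⟩
  j * 2 ^ j       ≤⟨ *-monoˡ-≤ (2 ^ j) (<⇒≤ (n<2^n j)) ⟩
  2 ^ j * 2 ^ j   ≡⟨ ^-distribˡ-+-* 2 j j ⟨
  2 ^ (j + j)     ≡⟨ cong (λ k → 2 ^ (j + k)) (+-identityʳ j) ⟨
  2 ^ (2 * j)     ∎
  where open ≤-Reasoning

-- Polynomial bounds in base `2 ^ d`

module _ {d : ℕ} (1≤d : 1 ≤ d) where

  2≤2^d : 2 ≤ 2 ^ d
  2≤2^d = ^-monoʳ-≤ 2 1≤d

  *-≤-2^ : ∀ {x y} e f → x ≤ 2 ^ (d * e) → y ≤ 2 ^ (d * f) → x * y ≤ 2 ^ (d * (e + f))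
  *-≤-2^ e f h k = ≤-trans (*-mono-≤ h k)
    (≤-reflexive (trans (sym (^-distribˡ-+-* 2 (d * e) (d * f))) (cong (2 ^_) (sym (*-distribˡ-+ d e f)))))

  suc-≤-2^ : ∀ {x} e → x ≤ 2 ^ (d * e) → suc x ≤ 2 ^ (d * suc e)
  suc-≤-2^ {x} e h = begin
    suc x                         ≤⟨ +-mono-≤ (m^n>0 2 (d * e)) h ⟩
    2 ^ (d * e) + 2 ^ (d * e)     ≡⟨ cong (_+_ (2 ^ (d * e))) (+-identityʳ (2 ^ (d * e))) ⟨
    2 * 2 ^ (d * e)               ≤⟨ *-monoˡ-≤ (2 ^ (d * e)) 2≤2^d ⟩
    2 ^ d * 2 ^ (d * e)           ≡⟨ ^-distribˡ-+-* 2 d (d * e) ⟨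
    2 ^ (d + d * e)               ≡⟨ cong (2 ^_) (*-suc d e) ⟨
    2 ^ (d * suc e)               ∎
    where open ≤-Reasoning

-- With n ≤ 2^(1+d), E ≤ n^b and w ≤ γ d, the quantity 2 (1 + M) (1 + M 2^w)
-- is at most 2^(d · transcript-exponent b γ) for M = E · budget j.
transcript-exponent : ℕ → ℕ → ℕ
transcript-exponent b γ = 1 + (suc (b * 2 + 2) + suc (b * 2 + 2 + γ))

-- All polynomial assumptions meet here. In base `2 ^ d`, `E` has exponent `b * 2` as n is at most
-- the square of the base, `budget j` has exponent 2, the word contributes γ, and each successor as
-- well as the leading factor 2 costs one more. On the other side, `2 ^ d ≤ n ≤ n ^ p ≤ U ^ q`
-- trades this base for powers of `suc U`.
few-transcripts : ∀ p q b γ {n U E w d j} → .{{_ : NonZero p}} → 1 ≤ d → j ≤ d → 2 ^ d ≤ n → n ≤ 2 ^ suc d →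
  n ^ p ≤ U ^ q → E ≤ n ^ b → w ≤ γ * d →
  let M = E * budget j in
  2 * (suc M * suc (M * 2 ^ w)) ≤ suc U ^ (2 ^ (q * transcript-exponent b γ))
few-transcripts p@(suc p′) q b γ {n} {U} {E} {w} {d} {j} 1≤d j≤d 2^d≤n n≤2^1+d n^p≤U^q E≤n^b w≤γd = begin
  2 * (suc M * suc (M * 2 ^ w))
    ≤⟨ *-≤-2^ 1≤d 1 (suc (b * 2 + 2) + suc (b * 2 + 2 + γ))
         (≤-trans (2≤2^d 1≤d) (≤-reflexive (cong (2 ^_) (sym (*-identityʳ d)))))
         (*-≤-2^ 1≤d (suc (b * 2 + 2)) (suc (b * 2 + 2 + γ)) (suc-≤-2^ 1≤d (b * 2 + 2) M≤)
           (suc-≤-2^ 1≤d (b * 2 + 2 + γ) (*-≤-2^ 1≤d (b * 2 + 2) γ M≤ W≤))) ⟩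
  2 ^ (d * α)
    ≡⟨ ^-*-assoc 2 d α ⟨
  (2 ^ d) ^ α
    ≤⟨ ^-monoˡ-≤ α 2^d≤U^q ⟩
  (suc U ^ q) ^ α
    ≡⟨ ^-*-assoc (suc U) q α ⟩
  suc U ^ (q * α)
    -- A block size must be a power of two; the generous choice g = q α avoids taking a logarithm
    -- and still is a constant.
    ≤⟨ ^-monoʳ-≤ (suc U) (<⇒≤ (n<2^n (q * α))) ⟩
  suc U ^ (2 ^ (q * α)) ∎
  where
  open ≤-Reasoning
  M = E * budget j
  α = transcript-exponent b γ

  E≤ : E ≤ 2 ^ (d * (b * 2))
  E≤ = begin
    E                   ≤⟨ E≤n^b ⟩
    n ^ b               ≤⟨ ^-monoˡ-≤ b n≤2^1+d ⟩
    (2 ^ suc d) ^ b     ≡⟨ ^-*-assoc 2 (suc d) b ⟩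
    2 ^ (suc d * b)     ≤⟨ ^-monoʳ-≤ 2 (*-monoˡ-≤ b (+-monoˡ-≤ d 1≤d)) ⟩
    2 ^ ((d + d) * b)   ≡⟨ cong (2 ^_) (solve 2 (λ d b → (d :+ d) :* b := d :* (b :* con 2)) refl d b) ⟩
    2 ^ (d * (b * 2))   ∎

  M≤ : M ≤ 2 ^ (d * (b * 2 + 2))
  M≤ = *-≤-2^ 1≤d (b * 2) 2 E≤ (≤-trans (budget≤2^2j j)
    (^-monoʳ-≤ 2 (≤-trans (*-monoʳ-≤ 2 j≤d) (≤-reflexive (*-comm 2 d)))))

  W≤ : 2 ^ w ≤ 2 ^ (d * γ)
  W≤ = ^-monoʳ-≤ 2 (≤-trans w≤γd (≤-reflexive (*-comm γ d)))

  2^d≤U^q : 2 ^ d ≤ suc U ^ q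
  2^d≤U^q = begin
    2 ^ d       ≤⟨ 2^d≤n ⟩
    n           ≡⟨ *-identityʳ n ⟨
    n * 1       ≤⟨ *-monoʳ-≤ n (m^n>0 n {{>-nonZero (≤-trans (m^n>0 2 d) 2^d≤n)}} p′) ⟩
    n ^ p       ≤⟨ n^p≤U^q ⟩
    U ^ q       ≤⟨ ^-monoˡ-≤ q (n≤1+n U) ⟩
    suc U ^ q   ∎

-- Three factors of 2: rounding n to a power of two, `j + g ≤ 2 j` for the abandoned levels, and
-- `budget j = j 2^j / 2`. The factor `2 ^ g` is the number of values that pay for one transcript
-- entry.
n*d≤budget : ∀ {n} j g → g ≤ j → n ≤ 2 ^ suc (j + g) → n * (j + g) ≤ 8 * 2 ^ g * budget j
n*d≤budget {n} j g g≤j n≤ = begin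
  n * (j + g)                    ≤⟨ *-mono-≤ n≤ (+-monoʳ-≤ j g≤j) ⟩
  2 * 2 ^ (j + g) * (j + j)      ≡⟨ cong (λ k → 2 * k * (j + j)) (^-distribˡ-+-* 2 j g) ⟩
  2 * (2 ^ j * 2 ^ g) * (j + j)  ≡⟨ solve 3 (λ j a c → con 2 :* (a :* c) :* (j :+ j) := con 4 :* c :* (j :* a)) refl j (2 ^ j) (2 ^ g) ⟩
  4 * 2 ^ g * (j * 2 ^ j)        ≡⟨ cong (4 * 2 ^ g *_) (double-budget j) ⟨
  4 * 2 ^ g * (2 * budget j)     ≡⟨ solve 4 (λ k l c b → k :* c :* (l :* b) := k :* l :* c :* b) refl 4 2 (2 ^ g) (budget j) ⟩
  8 * 2 ^ g * budget j           ∎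
  where open ≤-Reasoning

-- Assembly of the lower bound

epoch-lower-bound : ∀ {n U w E j g} .{{_ : NonZero n}} → let M = E * budget j in
  2 * (suc M * suc (M * 2 ^ w)) ≤ suc U ^ (2 ^ g) → 2 ^ (j + g) ≤ n →
  (A : Array n U) (D : LasVegasPartialSums n U w E A) →
  Σ[ ops ∈ List (Op n U) ] EpochBased E ops × (length ops ≡ 2 * (E * n)) ×
    (∃[ k ] E * budget j * (2 ^ k) ^ suc (length ops) ≤
       8 * sumOver (allCoins k (length ops)) (probes (LasVegasPartialSums.algorithm D) ops))
epoch-lower-bound {n} {U} {w} {E} {j} {g} few 2^d≤n A D =
  instantiate s (proj₁ hard) , epochBased (proj₁ hard) , length-ops , proj₂ hard
  where
  open LasVegasPartialSums D
  M = E * budget j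
  s : Skeleton n U
  s = repeated E (epoch (j + g))

  epochBased : ∀ x → EpochBased E (instantiate s x)
  epochBased = repeated-epochBased E (epoch (j + g)) (epoch-isEpoch (j + g) 2^d≤n)

  nonzero : NonZero (2 * card s)
  nonzero = >-nonZero (*-mono-≤ {1} {2} (s≤s z≤n) (card>0 s))

  rarely : ∀ x → ∃[ k ] Rarely algorithm (2 * card s) (instantiate s x) k
  -- The tolerance is chosen for a union bound over all `card s` sequences that still leaves half of
  -- the coins.
  rarely x with halts (instantiate s x) (epochBased x) (((+ 1) ℚᵘ./ (2 * card s)) {{nonzero}}) (0<1/ (2 * card s) {{nonzero}})
  ... | k , h = k , ≤-trans (/-cancel-≤ (sumOver (allCoins k T) (undefined algorithm (instantiate s x))) ((2 ^ k) ^ suc T) 1 (2 * card s)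
      {{m^n≢0 (2 ^ k) (suc T) {{m^n≢0 2 k}}}} {{nonzero}} h) (≤-reflexive (*-identityˡ _))
    where T = length (instantiate s x)

  hard : ∃[ x ] ∃[ k ] E * budget j * (2 ^ k) ^ suc (length (instantiate s x)) ≤
           8 * sumOver (allCoins k (length (instantiate s x))) (probes algorithm (instantiate s x))
  hard = hard-instance algorithm A s (λ x → correct (instantiate s x) (epochBased x)) M (E * budget j)
    (deterministic-bound M j g E few 2^d≤n ≤-refl) rarely

  length-ops : length (instantiate s (proj₁ hard)) ≡ 2 * (E * n)
  length-ops = begin
    length (instantiate s (proj₁ hard)) ≡⟨ length-instantiate s (proj₁ hard) ⟩
    size s                              ≡⟨ size-repeated E (epoch (j + g)) ⟩
    E * size (epoch {n} {U} (j + g))    ≡⟨ cong (E *_) (size-epoch (j + g) 2^d≤n) ⟩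
    E * (2 * n)                         ≡⟨ solve 2 (λ e n → e :* (con 2 :* n) := con 2 :* (e :* n)) refl E n ⟩
    2 * (E * n)                         ∎
    where open ≡-Reasoning

64*2^g≢0 : ∀ g → NonZero (64 * 2 ^ g)
64*2^g≢0 g = m*n≢0 64 (2 ^ g) {{_}} {{m^n≢0 2 g}}

-- The 64 is 8 from averaging over coins and values times 8 from comparing `budget j` with
-- `n * (j + g)`.
expected-lower-bound : ∀ {n U w E} j g .{{_ : NonZero n}} → let M = E * budget j in
  2 * (suc M * suc (M * 2 ^ w)) ≤ suc U ^ (2 ^ g) → g ≤ j → 2 ^ (j + g) ≤ n → n ≤ 2 ^ suc (j + g) →
  (A : Array n U) (D : LasVegasPartialSums n U w E A) →
  Σ[ ops ∈ List (Op n U) ] EpochBased E ops × (length ops ≡ 2 * (E * n)) ×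
    ExpectedProbes≥ (LasVegasPartialSums.algorithm D) ops
      (((+ 1) ℚᵘ./ (64 * 2 ^ g)) {{64*2^g≢0 g}} ℚᵘ.* ((+ (E * n * (j + g))) ℚᵘ./ 1))
expected-lower-bound {n} {U} {w} {E} j g few g≤j 2^d≤n n≤2^1+d A D =
  -- One truncation level already reaches the bound itself, so it serves every `r` below it.
  ops , epochBased , len , λ r r<b → k , ℚᵘ.≤-trans (ℚᵘ.<⇒≤ r<b)
    (1/-*-≤ (64 * 2 ^ g) (E * n * (j + g)) S N {{64*2^g≢0 g}} {{m^n≢0 (2 ^ k) (suc (length ops)) {{m^n≢0 2 k}}}} scaled)
  where
  hard = epoch-lower-bound {n} {U} {w} {E} {j} {g} few 2^d≤n A D
  ops = proj₁ hard
  epochBased = proj₁ (proj₂ hard)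
  len = proj₁ (proj₂ (proj₂ hard))
  k = proj₁ (proj₂ (proj₂ (proj₂ hard)))
  N = (2 ^ k) ^ suc (length ops)
  S = sumOver (allCoins k (length ops)) (probes (LasVegasPartialSums.algorithm D) ops)

  scaled : E * n * (j + g) * N ≤ 64 * 2 ^ g * S
  scaled = begin
    E * n * (j + g) * N
      ≡⟨ cong (_* N) (*-assoc E n (j + g)) ⟩
    E * (n * (j + g)) * N
      ≤⟨ *-monoˡ-≤ N (*-monoʳ-≤ E (n*d≤budget j g g≤j n≤2^1+d)) ⟩
    E * (8 * 2 ^ g * budget j) * N
      ≡⟨ solve 4 (λ e c b t → e :* (c :* b) :* t := c :* (e :* b :* t)) refl E (8 * 2 ^ g) (budget j) N ⟩
    8 * 2 ^ g * (E * budget j * N)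
      ≤⟨ *-monoʳ-≤ (8 * 2 ^ g) (proj₂ (proj₂ (proj₂ (proj₂ hard)))) ⟩
    8 * 2 ^ g * (8 * S)
      ≡⟨ solve 3 (λ e c s → e :* c :* (e :* s) := e :* e :* c :* s) refl 8 (2 ^ g) S ⟩
    64 * 2 ^ g * S ∎
    where open ≤-Reasoning

-- This determines the threshold for n: more than half of the levels must remain after g of them are
-- given up. The strict inequality also makes the logarithm positive.
log-split : ∀ n g → 2 ^ suc (g + g) ≤ n → ∃[ j ] g < j × ⌊log₂ n ⌋ ≡ j + g
log-split n g h = ⌊log₂ n ⌋ ∸ g , m+n≤o⇒m≤o∸n (suc g) 2g<d , sym (m∸n+n≡m (≤-trans (m≤n+m g (suc g)) 2g<d))
  where
  2g<d : suc (g + g) ≤ ⌊log₂ n ⌋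
  2g<d = ≤-trans (≤-reflexive (sym (⌊log₂[2^n]⌋≡n (suc (g + g))))) (⌊log₂⌋-mono-≤ h)

theorem25 : (p q b γ₁ γ₂ : ℕ) → .{{_ : NonZero p}} → .{{_ : NonZero q}} →
    Σ[ c ∈ ℚᵘ ] (0ℚᵘ ℚᵘ.< c) × (Σ[ n₀ ∈ ℕ ]
    ((n U E w : ℕ) → n₀ ≤ n →
    n ^ p ≤ U ^ q →
    E ≤ n ^ b →
    ⌊log₂ n ⌋ ≤ γ₁ * w → w ≤ γ₂ * ⌊log₂ n ⌋ →
    (A : Array n U) (D : LasVegasPartialSums n U w E A) →
    Σ[ ops ∈ List (Op n U) ]
    EpochBased E ops ×
    (length ops ≡ 2 * (E * n)) ×
    ExpectedProbes≥ (LasVegasPartialSums.algorithm D) ops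
    (c ℚᵘ.* ((+ (E * n * ⌊log₂ n ⌋)) ℚᵘ./ 1))))
theorem25 p q b γ₁ γ₂ = ((+ 1) ℚᵘ./ (64 * 2 ^ g)) {{64*2^g≢0 g}} , 0<1/ (64 * 2 ^ g) {{64*2^g≢0 g}} , 2 ^ suc (g + g) ,
  λ n U E w n₀≤n n^p≤U^q E≤n^b _ w≤γd A D →
    bound n₀≤n n^p≤U^q E≤n^b (2^⌊log₂n⌋≤n n (1≤n n₀≤n)) (n≤2^1+⌊log₂n⌋ n) w≤γd (log-split n g n₀≤n) A D
  where
  -- Depends only on the exponents of the assumptions and not on n, so that `1 / (64 * 2 ^ g)` is a
  -- legitimate constant.
  g = q * transcript-exponent b γ₂

  1≤n : ∀ {n} → 2 ^ suc (g + g) ≤ n → 1 ≤ n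
  1≤n = ≤-trans (m^n>0 2 (suc (g + g)))

  bound : ∀ {n U E w d} → 2 ^ suc (g + g) ≤ n → n ^ p ≤ U ^ q → E ≤ n ^ b → 2 ^ d ≤ n → n ≤ 2 ^ suc d →
    w ≤ γ₂ * d → ∃[ j ] g < j × d ≡ j + g → (A : Array n U) (D : LasVegasPartialSums n U w E A) →
    Σ[ ops ∈ List (Op n U) ] EpochBased E ops × (length ops ≡ 2 * (E * n)) ×
      ExpectedProbes≥ (LasVegasPartialSums.algorithm D) ops
        (((+ 1) ℚᵘ./ (64 * 2 ^ g)) {{64*2^g≢0 g}} ℚᵘ.* ((+ (E * n * d)) ℚᵘ./ 1))
  bound n₀≤n n^p≤U^q E≤n^b 2^d≤n n≤2^1+d w≤γd (j , g<j , refl) =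
    expected-lower-bound j g {{>-nonZero (1≤n n₀≤n)}}
      (few-transcripts p q b γ₂ (≤-trans (s≤s z≤n) (≤-trans g<j (m≤m+n j g))) (m≤m+n j g) 2^d≤n n≤2^1+d n^p≤U^q E≤n^b w≤γd)
      (<⇒≤ g<j) 2^d≤n n≤2^1+d
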